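{- Let $k=k(n)$ be a sequence of non-negative integers with $k=n^{o(1)}$ as $n\to\infty$. Then, as $n\to\infty$, $$m(n,k)=n^{(1+o(1))\binom{n}{k}},$$ where $m(n,k)$ denotes the number of maximal families in $\mathcal{P}(n)$ of VC dimension $k$.
   Context: $\mathcal{P}(n)$ is the power set of $[n]=\{1,\dots,n\}$. A family $\mathcal{F}\subseteq\mathcal{P}(n)$ shatters $S\subseteq[n]$ if for every $A\subseteq S$ there is $B\in\mathcal{F}$ with $B\cap S=A$. The VC dimension $\mathrm{VC}(\mathcal{F})$ is the maximum size of a set shattered by $\mathcal{F}$. Write $\binom{n}{\le k}=\sum_{i=0}^k\binom{n}{i}$. By the Sauer–Shelah lemma $|\mathcal{F}|\le\binom{n}{\le \mathrm{VC}(\mathcal{F})}$; a family $\mathcal{F}$ is called maximal if $|\mathcal{F}|=\binom{n}{\le \mathrm{VC}(\mathcal{F})}$. $m(n,k)$ is the number of maximal families $\mathcal{F}\subseteq\mathcal{P}(n)$ with $\mathrm{VC}(\mathcal{F})=k$.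
   Formalization: The sequence k(n) is taken to be positive (k(n) ≥ 1) rather than non-negative, since for k = 0 one has m(n,0) = 2^n, which is not n^{(1+o(1))·1}. -}

module Defs where

open import Data.Bool using (Bool; true; false; _∧_; _∨_; not) renaming (_≟_ to _≟ᵇ_)
open import Data.Nat using (ℕ; zero; suc; _+_; _≤ᵇ_; _≡ᵇ_)
open import Data.Nat.Combinatorics using (_C_)
open import Data.List using (List; []; _∷_; [_]; map; _++_; filter; length)
open import Data.Bool.ListAction using (all; any)
open import Data.Vec using (Vec; []; _∷_)
open import Data.Fin.Subset using (Subset; inside; outside; _∩_; _⊆_; ∣_∣)
open import Data.Fin.Subset.Properties using (_⊆?_)
open import Relation.Nullary using (does)

_==_ : ∀ {n} → Subset n → Subset n → Bool
[] == [] = true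
(x ∷ xs) == (y ∷ ys) = eqB x y ∧ (xs == ys)
  where
  eqB : Bool → Bool → Bool
  eqB true true = true
  eqB false false = true
  eqB _ _ = false

allSubsets : (n : ℕ) → List (Subset n)
allSubsets zero = [ [] ]
allSubsets (suc n) = map (outside ∷_) (allSubsets n) ++ map (inside ∷_) (allSubsets n)

-- All sublists of a list (= all subfamilies when the list has no repetitions).
sublists : ∀ {a} {A : Set a} → List A → List (List A)
sublists [] = [ [] ]
sublists (x ∷ xs) = sublists xs ++ map (x ∷_) (sublists xs)

-- A family: a list of distinct subsets of [n] (all families are obtained
-- as sublists of allSubsets n, hence without repetition).
Family : ℕ → Set
Family n = List (Subset n)

shatters : ∀ {n} → Family n → Subset n → Bool
shatters {n} F S =
  all (λ A → any (λ B → (B ∩ S) == A) F)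
      (filter (λ A → A ⊆? S) (allSubsets n))

hasVC : ∀ {n} → Family n → ℕ → Bool
hasVC {n} F k =
  any (λ S → (∣ S ∣ ≡ᵇ k) ∧ shatters F S) (allSubsets n)
  ∧ not (any (λ S → (suc k ≤ᵇ ∣ S ∣) ∧ shatters F S) (allSubsets n))

binom≤ : ℕ → ℕ → ℕ
binom≤ n zero = n C 0
binom≤ n (suc k) = binom≤ n k + n C (suc k)

isMaximalVC : ∀ {n} → Family n → ℕ → Bool
isMaximalVC {n} F k = hasVC F k ∧ (length F ≡ᵇ binom≤ n k)

m : ℕ → ℕ → ℕ
m n k = length (filter (λ F → isMaximalVC F k ≟ᵇ true) (sublists (allSubsets n)))

{-# OPTIONS --safe #-}

-- Upper bound. A maximum family F of VC dimension k is a connected subset of the cube: by equality in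
-- the Sauer–Shelah bound, projecting out one coordinate commutes with taking the link (the sets
-- present with both values) of another, so every edge of a projection of F lifts to an edge of F,
-- and connectivity passes from the projection to F. A depth-first traversal encodes a connected
-- family of B points by a start and a word with B - 1 moves and B - 1 backtracks, so there are at
-- most 2^n 4^B n^B of them, where B = (1 + o(1)) n C k.
--
-- Lower bound. Split [n] into two parts, the second of size w. In the family of all sets of size
-- at most k, replace every k-subset a of the first part by a ∪ {f a} for an arbitrary f a in the
-- second part. The pairs (a , a ∪ {f a}) form an induced matching between two layers, whence the VC
-- dimension stays k. With w = n^{1-o(1)} and w k = o(n) there are w^{(1-o(1)) n C k} choices of f.
module Submission where

open import Defs
open import Data.Nat using (ℕ; _≤_; _^_; _*_; _+_; _∸_)
open import Data.Nat.Combinatorics using (_C_)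
open import Data.Product using (∃; _×_)

open import Data.Bool using (Bool; true; false; T; _∧_; _∨_; not; if_then_else_) renaming (_≟_ to _≟ᵇ_)
open import Data.Bool.Properties using (T-≡; T-∧; ∧-zeroʳ)
open import Data.Fin using (Fin; zero; suc; finToFun; funToFin; combine)
open import Data.Fin.Properties using (funToFin-finToFin)
open import Data.Fin.Subset using (Subset; _∩_; ∣_∣; inside; outside; ⊥; ⁅_⁆) renaming (_⊆_ to _⊆ˢ_; _∈_ to _∈ˢ_)
open import Data.Fin.Subset.Properties using (_⊆?_; p∩q⊆p; p∩q⊆q; x∈p∩q⁺; ⊆-antisym; ∣⊥∣≡0; ∣⁅x⁆∣≡1;
  ∣p∩q∣≤∣p∣; ∣p∩q∣≤∣q∣; ∩-zeroˡ; ∩-zeroʳ; ∩-idem; ∩-assoc; x∈⁅x⁆; x∈⁅y⁆⇒x≡y)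
open import Data.List using (List; []; _∷_; _++_; map; filter; length; lookup; cartesianProductWith; allFin)
open import Data.List.Properties using (length-map; length-++; length-tabulate; filter-++; filter-≐;
  filter-accept; filter-reject)
import Data.List.Membership.DecPropositional as DecMembership
open import Data.List.Membership.Propositional using (_∈_; _∉_; find; lose)
open import Data.List.Membership.Propositional.Properties
open import Data.List.Relation.Binary.Permutation.Propositional using (_↭_; prep; swap; ↭-refl; ↭-sym; ↭-trans; ↭⇒↭ₛ)
open import Data.List.Relation.Binary.Permutation.Propositional.Properties using (∈-resp-↭)
open import Data.List.Relation.Binary.Permutation.Setoid.Properties using (Unique-resp-↭)
open import Data.List.Relation.Binary.Subset.Propositional using (_⊆_)
open import Data.List.Relation.Unary.All as All using (All; []; _∷_)
open import Data.List.Relation.Unary.All.Properties using (all⁺; all⁻; ¬Any⇒All¬; ¬All⇒Any¬)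
open import Data.List.Relation.Unary.AllPairs using ([]; _∷_)
open import Data.List.Relation.Unary.Any using (Any; here; there; index)
open import Data.List.Relation.Unary.Any.Properties using (any⁺; any⁻; lookup-index)
open import Data.List.Relation.Unary.Unique.Propositional using (Unique)
import Data.List.Relation.Unary.Unique.Propositional.Properties as Unique
open import Data.Maybe using (Maybe; just; nothing)
open import Data.Nat using (zero; suc; pred; _<_; _⊔_; _≤ᵇ_; _<ᵇ_; _≡ᵇ_; z≤n; s≤s; s≤s⁻¹;
  NonZero; >-nonZero; >-nonZero⁻¹)
open import Data.Nat.Combinatorics using (nCk+nC[k+1]≡[n+1]C[k+1]; nC1≡n)
open import Data.Nat.DivMod using (_/_; _%_; m≡m%n+[m/n]*n; m%n<n; m/n*n≤m; m*n/n≡m; /-monoˡ-≤)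
open import Data.Nat.Properties
open import Data.Nat.Solver using (module +-*-Solver)
open import Data.Product using (_,_; proj₁; proj₂)
open import Data.Sum using (inj₁; inj₂)
open import Data.Vec as Vec using ([]; _∷_; insertAt; removeAt; updateAt; take; drop)
open import Data.Vec.Properties using (≡-dec; ∷-injectiveʳ; insertAt-removeAt; take++drop≡id; zipWith-++; ++-injective)
open import Algebra.Properties.CommutativeSemigroup +-commutativeSemigroup using (interchange)
open import Function using (_∘_; id; case_of_; Equivalence; _⇔_; mk⇔)
open import Level using (Level)
open import Relation.Binary.Construct.Closure.ReflexiveTransitive as Star using (Star; ε; _◅_; _◅◅_)
open import Relation.Binary.PropositionalEquality
open import Relation.Nullary using (¬_; Dec; yes; no; does; contradiction)
open import Relation.Nullary.Decidable using (dec-true)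
open import Relation.Unary using (Decidable)
open Equivalence using (to; from)

-- Estimates for binomial coefficients

[1+k]*[1+n]C[1+k]≡[1+n]*nCk : ∀ n k → suc k * (suc n C suc k) ≡ suc n * (n C k)
[1+k]*[1+n]C[1+k]≡[1+n]*nCk zero    zero    = refl
[1+k]*[1+n]C[1+k]≡[1+n]*nCk zero    (suc k) = *-zeroʳ (2 + k)
[1+k]*[1+n]C[1+k]≡[1+n]*nCk (suc n) zero    = trans (*-identityˡ _) (trans (nC1≡n (2 + n)) (sym (*-identityʳ (2 + n))))
[1+k]*[1+n]C[1+k]≡[1+n]*nCk (suc n) (suc k) = begin
  (2 + k) * ((2 + n) C (2 + k))
    ≡⟨ cong ((2 + k) *_) (nCk+nC[k+1]≡[n+1]C[k+1] (suc n) (suc k)) ⟨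
  (2 + k) * (x + y)
    ≡⟨ solve 3 (λ k x y → (con 2 :+ k) :* (x :+ y) := x :+ ((con 1 :+ k) :* x :+ (con 2 :+ k) :* y)) refl k x y ⟩
  x + (suc k * x + (2 + k) * y)
    ≡⟨ cong (x +_) (cong₂ _+_ ([1+k]*[1+n]C[1+k]≡[1+n]*nCk n k) ([1+k]*[1+n]C[1+k]≡[1+n]*nCk n (suc k))) ⟩
  x + (suc n * (n C k) + suc n * (n C suc k))
    ≡⟨ cong (x +_) (*-distribˡ-+ (suc n) (n C k) (n C suc k)) ⟨
  x + suc n * (n C k + n C suc k)
    ≡⟨ cong (λ z → x + suc n * z) (nCk+nC[k+1]≡[n+1]C[k+1] n k) ⟩
  (2 + n) * x ∎
  where
  open ≡-Reasoning
  open +-*-Solver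
  x = suc n C suc k
  y = suc n C (2 + k)

-- By Pascal's rule the claim says that `suc r * (n C i)` is at most `suc n C suc i`, and by
-- absorption the latter is `n C i` times `(n + 1) / (i + 1)`.
C-ratio : ∀ r n i → suc r * suc i ≤ suc n → r * (n C i) ≤ n C suc i
C-ratio r n i r≤n = +-cancelˡ-≤ (n C i) _ _ (*-cancelˡ-≤ (suc i) (begin
  suc i * (suc r * (n C i))
    ≡⟨ solve 3 (λ i r c → (con 1 :+ i) :* ((con 1 :+ r) :* c) := ((con 1 :+ r) :* (con 1 :+ i)) :* c) refl i r (n C i) ⟩
  (suc r * suc i) * (n C i)         ≤⟨ *-monoˡ-≤ (n C i) r≤n ⟩
  suc n * (n C i)                   ≡⟨ [1+k]*[1+n]C[1+k]≡[1+n]*nCk n i ⟨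
  suc i * (suc n C suc i)           ≡⟨ cong (suc i *_) (nCk+nC[k+1]≡[n+1]C[k+1] n i) ⟨
  suc i * (n C i + n C suc i)       ∎))
  where
  open ≤-Reasoning
  open +-*-Solver

-- Geometric decay of the lower layers: each layer up to `k` is at least `r + 1` times the previous
-- one, so the partial sum exceeds its last term by a factor of at most `1 + 1/r`.
binom≤-ratio : ∀ r n k → (2 + r) * k ≤ suc n → r * binom≤ n k ≤ suc r * (n C k)
binom≤-ratio r n zero    _   = *-monoˡ-≤ 1 (n≤1+n r)
binom≤-ratio r n (suc k) r≤n = begin
  r * (binom≤ n k + n C suc k)               ≡⟨ *-distribˡ-+ r (binom≤ n k) (n C suc k) ⟩
  r * binom≤ n k + r * (n C suc k)
    ≤⟨ +-monoˡ-≤ _ (binom≤-ratio r n k (≤-trans (*-monoʳ-≤ (2 + r) (n≤1+n k)) r≤n)) ⟩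
  suc r * (n C k) + r * (n C suc k)          ≤⟨ +-monoˡ-≤ _ (C-ratio (suc r) n k r≤n) ⟩
  suc r * (n C suc k)                        ∎
  where open ≤-Reasoning

-- The coefficients do not decrease from `n C 1` on in this range. Serves to absorb the `2 ^ n`
-- start points of a traversal into `2 ^ (n C suc k)`.
n≤nCk : ∀ n k → 2 * suc k ≤ suc n → n ≤ n C suc k
n≤nCk n zero    _   = ≤-reflexive (sym (nC1≡n n))
n≤nCk n (suc k) k≤n = begin
  n                   ≤⟨ n≤nCk n k (≤-trans (*-monoʳ-≤ 2 (n≤1+n (suc k))) k≤n) ⟩
  n C suc k           ≡⟨ *-identityˡ (n C suc k) ⟨
  1 * (n C suc k)     ≤⟨ C-ratio 1 n (suc k) k≤n ⟩
  n C (2 + k)         ∎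
  where open ≤-Reasoning

nCk≤[1+n]Ck : ∀ n k → n C k ≤ suc n C k
nCk≤[1+n]Ck n zero    = ≤-refl
nCk≤[1+n]Ck n (suc k) = ≤-trans (m≤n+m (n C suc k) (n C k)) (≤-reflexive (nCk+nC[k+1]≡[n+1]C[k+1] n k))

-- Union bound: a set that leaves the first `r` points contains one of the other `suc w`, and its
-- remaining `k` elements are chosen from `r + w` points.
C-deletion : ∀ r w k → (r + suc w) C suc k ≤ r C suc k + suc w * ((r + w) C k)
C-deletion r zero k = ≤-reflexive (begin
  (r + 1) C suc k                   ≡⟨ cong (_C suc k) (+-comm r 1) ⟩
  suc r C suc k                     ≡⟨ nCk+nC[k+1]≡[n+1]C[k+1] r k ⟨
  r C k + r C suc k                 ≡⟨ +-comm (r C k) (r C suc k) ⟩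
  r C suc k + r C k                 ≡⟨ cong (λ z → r C suc k + z C k) (+-identityʳ r) ⟨
  r C suc k + (r + 0) C k           ≡⟨ cong (r C suc k +_) (*-identityˡ ((r + 0) C k)) ⟨
  r C suc k + 1 * ((r + 0) C k)     ∎)
  where open ≡-Reasoning
C-deletion r (suc w) k = begin
  (r + (2 + w)) C suc k                           ≡⟨ cong (_C suc k) (+-suc r (suc w)) ⟩
  suc n C suc k                                   ≡⟨ nCk+nC[k+1]≡[n+1]C[k+1] n k ⟨
  n C k + n C suc k                               ≤⟨ +-monoʳ-≤ (n C k) (C-deletion r w k) ⟩
  n C k + (r C suc k + suc w * ((r + w) C k))
    ≤⟨ +-monoʳ-≤ (n C k) (+-monoʳ-≤ (r C suc k) (*-monoʳ-≤ (suc w) mono)) ⟩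
  n C k + (r C suc k + suc w * (n C k))
    ≡⟨ solve 3 (λ x y w → x :+ (y :+ w :* x) := y :+ (x :+ w :* x)) refl (n C k) (r C suc k) (suc w) ⟩
  r C suc k + (2 + w) * (n C k)                   ∎
  where
  open ≤-Reasoning
  open +-*-Solver
  n = r + suc w
  mono : (r + w) C k ≤ n C k
  mono = subst (λ z → (r + w) C k ≤ z C k) (sym (+-suc r w)) (nCk≤[1+n]Ck (r + w) k)

-- By absorption the loss in `C-deletion` is the fraction `(w + 1)(k + 1) / N` of `N C suc k`, hence
-- at most `1/d` of it.
C-deletion-ratio : ∀ d r w k → d * (suc w * suc k) ≤ r + suc w →
  d * ((r + suc w) C suc k) ≤ d * (r C suc k) + (r + suc w) C suc k
C-deletion-ratio d r w k small rewrite +-suc r w = begin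
  d * (N C suc k)
    ≤⟨ *-monoʳ-≤ d (subst (λ z → z C suc k ≤ r C suc k + suc w * c) (+-suc r w) (C-deletion r w k)) ⟩
  d * (r C suc k + suc w * c)                         ≡⟨ *-distribˡ-+ d (r C suc k) (suc w * c) ⟩
  d * (r C suc k) + d * (suc w * c)                   ≤⟨ +-monoʳ-≤ (d * (r C suc k)) (*-cancelˡ-≤ N lost) ⟩
  d * (r C suc k) + N C suc k                         ∎
  where
  open ≤-Reasoning
  open +-*-Solver
  N = suc (r + w)
  c = (r + w) C k
  lost : N * (d * (suc w * c)) ≤ N * (N C suc k)
  lost = begin
    N * (d * (suc w * c))
      ≡⟨ solve 4 (λ N d w c → N :* (d :* (w :* c)) := d :* w :* (N :* c)) refl N d (suc w) c ⟩
    d * suc w * (N * c)                ≡⟨ cong (d * suc w *_) ([1+k]*[1+n]C[1+k]≡[1+n]*nCk (r + w) k) ⟨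
    d * suc w * (suc k * (N C suc k))
      ≡⟨ solve 4 (λ d w k c → d :* w :* (k :* c) := d :* (w :* k) :* c) refl d (suc w) (suc k) (N C suc k) ⟩
    d * (suc w * suc k) * (N C suc k)  ≤⟨ *-monoˡ-≤ (N C suc k) small ⟩
    N * (N C suc k)                    ∎

-- Powers

^-cancelʳ-≤ : ∀ {a b} e .{{_ : NonZero e}} → a ^ e ≤ b ^ e → a ≤ b
^-cancelʳ-≤ e aᵉ≤bᵉ = ≮⇒≥ λ b<a → <⇒≱ (^-monoˡ-< e b<a) aᵉ≤bᵉ

^-distribʳ-* : ∀ e a b → (a * b) ^ e ≡ a ^ e * b ^ e
^-distribʳ-* zero    a b = refl
^-distribʳ-* (suc e) a b = trans (cong (a * b *_) (^-distribʳ-* e a b))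
  (solve 4 (λ a b x y → a :* b :* (x :* y) := a :* x :* (b :* y)) refl a b (a ^ e) (b ^ e))
  where open +-*-Solver

m≤m^[1+e] : ∀ m .{{_ : NonZero m}} e → m ≤ m ^ suc e
m≤m^[1+e] m e = m≤m*n m (m ^ e) {{m^n≢0 m e}}

-- Shattering and connectivity of maximum families

-- With Boolean predicates in place of lists, projection and link are a pointwise `∨` and `∧`, and
-- sizes are computed by recursion on the coordinates.
Indicator : ℕ → Set
Indicator n = Subset n → Bool

private variable
  a : Level
  A : Set a
  n d r w k : ℕ
  P Q : Indicator n

size : Indicator n → ℕ
size {zero}  P = if P [] then 1 else 0
size {suc n} P = size (P ∘ (false ∷_)) + size (P ∘ (true ∷_))

infix 4 _⊑_
_⊑_ : Indicator n → Indicator n → Set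
P ⊑ Q = ∀ x → P x ≡ true → Q x ≡ true

size-mono : ∀ {n} {P Q : Indicator n} → P ⊑ Q → size P ≤ size Q
size-mono {zero} {P} {Q} P⊑Q with P [] in p | Q [] in q
... | false | _     = z≤n
... | true  | true  = ≤-refl
... | true  | false with () ← trans (sym q) (P⊑Q [] p)
size-mono {suc n} P⊑Q =
  +-mono-≤ (size-mono (λ x → P⊑Q (false ∷ x))) (size-mono (λ x → P⊑Q (true ∷ x)))

size-cong : ∀ {n} {P Q : Indicator n} → (∀ x → P x ≡ Q x) → size P ≡ size Q
size-cong P≗Q = ≤-antisym (size-mono λ x → trans (sym (P≗Q x))) (size-mono λ x → trans (P≗Q x))

size-empty : ∀ {n} {P : Indicator n} → (∀ x → P x ≢ true) → size P ≡ 0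
size-empty {zero} {P} empty with P [] in p
... | false = refl
... | true  = contradiction p (empty [])
size-empty {suc n} empty =
  cong₂ _+_ (size-empty λ x → empty (false ∷ x)) (size-empty λ x → empty (true ∷ x))

-- Through this, equality in the Sauer-Shelah bound passes to the projection and to the link
-- separately.
+-tight : ∀ {a b c e} → a ≤ c → b ≤ e → a + b ≡ c + e → a ≡ c × b ≡ e
+-tight {a} {b} {c} {e} a≤c b≤e eq = a≡c , +-cancelˡ-≡ c b e (trans (cong (_+ b) (sym a≡c)) eq)
  where
  a≡c : a ≡ c
  a≡c = ≤-antisym a≤c (+-cancelʳ-≤ b c a (≤-trans (+-monoʳ-≤ c b≤e) (≤-reflexive (sym eq))))

⊑-size-≡ : ∀ {n} {P Q : Indicator n} → P ⊑ Q → size P ≡ size Q → Q ⊑ P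
⊑-size-≡ {zero} {P} {Q} P⊑Q eq [] q with P [] | Q []
... | true  | _    = refl
... | false | true with () ← eq
⊑-size-≡ {suc n} {P} {Q} P⊑Q eq (b ∷ x) q with b
... | false = ⊑-size-≡ (λ x → P⊑Q (false ∷ x)) (proj₁ halves) x q
  where
  halves = +-tight (size-mono (λ x → P⊑Q (false ∷ x))) (size-mono (λ x → P⊑Q (true ∷ x))) eq
... | true  = ⊑-size-≡ (λ x → P⊑Q (true ∷ x)) (proj₂ halves) x q
  where
  halves = +-tight (size-mono (λ x → P⊑Q (false ∷ x))) (size-mono (λ x → P⊑Q (true ∷ x))) eq

size-∨-∧ : (P Q : Indicator n) → size P + size Q ≡ size (λ x → P x ∨ Q x) + size (λ x → P x ∧ Q x)
size-∨-∧ {zero} P Q with P [] | Q []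
... | false | false = refl
... | false | true  = refl
... | true  | false = refl
... | true  | true  = refl
size-∨-∧ {suc n} P Q = begin
  (size P₀ + size P₁) + (size Q₀ + size Q₁)
    ≡⟨ interchange (size P₀) _ _ _ ⟩
  (size P₀ + size Q₀) + (size P₁ + size Q₁)
    ≡⟨ cong₂ _+_ (size-∨-∧ P₀ Q₀) (size-∨-∧ P₁ Q₁) ⟩
  (size (λ x → P₀ x ∨ Q₀ x) + size (λ x → P₀ x ∧ Q₀ x)) + (size (λ x → P₁ x ∨ Q₁ x) + size (λ x → P₁ x ∧ Q₁ x))
    ≡⟨ interchange (size (λ x → P₀ x ∨ Q₀ x)) _ _ _ ⟩
  _ ∎
  where
  open ≡-Reasoning
  P₀ = P ∘ (false ∷_) ; P₁ = P ∘ (true ∷_) ; Q₀ = Q ∘ (false ∷_) ; Q₁ = Q ∘ (true ∷_)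

size-insertAt : (i : Fin (suc n)) (P : Indicator (suc n)) →
  size P ≡ size (λ x → P (insertAt x i false)) + size (λ x → P (insertAt x i true))
size-insertAt         zero    P = refl
size-insertAt {suc n} (suc i) P = trans
  (cong₂ _+_ (size-insertAt i (P ∘ (false ∷_))) (size-insertAt i (P ∘ (true ∷_))))
  (interchange (size (λ x → P (false ∷ insertAt x i false))) _ _ _)

project link : Fin (suc n) → Indicator (suc n) → Indicator n
project i P x = P (insertAt x i false) ∨ P (insertAt x i true)
link    i P x = P (insertAt x i false) ∧ P (insertAt x i true)

-- Inclusion-exclusion for the two sections at coordinate `i`; this is the recursion behind the
-- Sauer-Shelah bound.
size-project-link : (i : Fin (suc n)) (P : Indicator (suc n)) →
  size P ≡ size (project i P) + size (link i P)
size-project-link i P = trans (size-insertAt i P) (size-∨-∧ (λ x → P (insertAt x i false)) (λ x → P (insertAt x i true)))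

∈-project⁻ : ∀ i {x} → project i P x ≡ true → ∃ λ b → P (insertAt x i b) ≡ true
∈-project⁻ {P = P} i {x} px with P (insertAt x i false) in eq
... | true  = false , eq
... | false = true , px

∈-project⁺ : ∀ i {x} b → P (insertAt x i b) ≡ true → project i P x ≡ true
∈-project⁺ {P = P} i {x} false px rewrite px = refl
∈-project⁺ {P = P} i {x} true  px with P (insertAt x i false)
... | true  = refl
... | false = px

∈-link⁻ : ∀ i x → link i P x ≡ true → ∀ b → P (insertAt x i b) ≡ true
∈-link⁻ {P = P} i x px b with P (insertAt x i false) in eq₀ | P (insertAt x i true) in eq₁
∈-link⁻ i x px false | true | true = eq₀
∈-link⁻ i x px true  | true | true = eq₁

∈-link⁺ : ∀ i {x} → (∀ b → P (insertAt x i b) ≡ true) → link i P x ≡ true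
∈-link⁺ i px rewrite px false | px true = refl

-- Shattering under projection and link

-- Letting `A` range over all sets and comparing with `A ∩ S` avoids carrying proofs of `A ⊆ S`;
-- every subset of `S` has this form.
Shatters : Indicator n → Subset n → Set
Shatters P S = ∀ A → ∃ λ B → P B ≡ true × B ∩ S ≡ A ∩ S

insertAt-∩ : ∀ (B S : Subset n) i b s → insertAt B i b ∩ insertAt S i s ≡ insertAt (B ∩ S) i (b ∧ s)
insertAt-∩ B       S       zero    b s = refl
insertAt-∩ (x ∷ B) (y ∷ S) (suc i) b s = cong (_ ∷_) (insertAt-∩ B S i b s)

∩-insertAt : ∀ (A : Subset (suc n)) (S : Subset n) i s →
  A ∩ insertAt S i s ≡ insertAt (removeAt A i ∩ S) i (Vec.lookup A i ∧ s)
∩-insertAt A S i s = trans (cong (_∩ insertAt S i s) (sym (insertAt-removeAt A i)))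
  (insertAt-∩ (removeAt A i) S i (Vec.lookup A i) s)

∣insertAt-outside∣ : ∀ (S : Subset n) i → ∣ insertAt S i false ∣ ≡ ∣ S ∣
∣insertAt-outside∣ S           zero    = refl
∣insertAt-outside∣ (false ∷ S) (suc i) = ∣insertAt-outside∣ S i
∣insertAt-outside∣ (true ∷ S)  (suc i) = cong suc (∣insertAt-outside∣ S i)

∣insertAt-inside∣ : ∀ (S : Subset n) i → ∣ insertAt S i true ∣ ≡ suc ∣ S ∣
∣insertAt-inside∣ S           zero    = refl
∣insertAt-inside∣ (false ∷ S) (suc i) = ∣insertAt-inside∣ S i
∣insertAt-inside∣ (true ∷ S)  (suc i) = cong suc (∣insertAt-inside∣ S i)

Shatters-project : ∀ i {S} → Shatters (project i P) S → Shatters P (insertAt S i false)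
Shatters-project {P = P} i {S} sh A with sh (removeAt A i)
... | B , pB , eq with b , pb ← ∈-project⁻ {P = P} i pB = insertAt B i b , pb , (begin
  insertAt B i b ∩ insertAt S i false           ≡⟨ insertAt-∩ B S i b false ⟩
  insertAt (B ∩ S) i (b ∧ false)                ≡⟨ cong₂ (λ X → insertAt X i) eq
                                                     (trans (∧-zeroʳ b) (sym (∧-zeroʳ (Vec.lookup A i)))) ⟩
  insertAt (removeAt A i ∩ S) i (Vec.lookup A i ∧ false) ≡⟨ ∩-insertAt A S i false ⟨
  A ∩ insertAt S i false                        ∎)
  where open ≡-Reasoning

-- Over a member of the link both values at `i` occur, so the one that `A` prescribes can be chosen
-- and `i` joins the shattered set.
Shatters-link : ∀ i {S} → Shatters (link i P) S → Shatters P (insertAt S i true)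
Shatters-link {P = P} i {S} sh A with sh (removeAt A i)
... | B , pB , eq = insertAt B i (Vec.lookup A i) , ∈-link⁻ {P = P} i B pB (Vec.lookup A i) , (begin
  insertAt B i (Vec.lookup A i) ∩ insertAt S i true      ≡⟨ insertAt-∩ B S i (Vec.lookup A i) true ⟩
  insertAt (B ∩ S) i (Vec.lookup A i ∧ true)
    ≡⟨ cong (λ X → insertAt X i (Vec.lookup A i ∧ true)) eq ⟩
  insertAt (removeAt A i ∩ S) i (Vec.lookup A i ∧ true)  ≡⟨ ∩-insertAt A S i true ⟨
  A ∩ insertAt S i true                              ∎)
  where open ≡-Reasoning

-- The bound is strict so that d can drop to 0 under links, where the family is empty.
VC< : ℕ → Indicator n → Set
VC< d P = ∀ S → Shatters P S → ∣ S ∣ < d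

VC<-project : ∀ i → VC< d P → VC< d (project i P)
VC<-project i vc S sh = subst (_< _) (∣insertAt-outside∣ S i) (vc _ (Shatters-project i sh))

VC<-link : ∀ i → VC< (suc d) P → VC< d (link i P)
VC<-link i vc S sh = s≤s⁻¹ (subst (_< _) (∣insertAt-inside∣ S i) (vc _ (Shatters-link i sh)))

-- Any member would shatter the empty set.
VC<0⇒empty : VC< 0 P → ∀ x → P x ≢ true
VC<0⇒empty {n} vc x px with () ← vc ⊥ (λ A → x , px , trans (∩-zeroʳ x) (sym (∩-zeroʳ A)))

-- The sum of `n C i` over `i < d`, written as a recursion on `n` that mirrors the split into
-- projection and link.
binom< : ℕ → ℕ → ℕ
binom< n       zero    = 0
binom< zero    (suc d) = 1
binom< (suc n) (suc d) = binom< n (suc d) + binom< n d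

-- Projection keeps the parameter `d` and the link lowers it by one, so the two inductive bounds add
-- up to the recursion of `binom<`.
sauer-shelah : ∀ {n d} (P : Indicator n) → VC< d P → size P ≤ binom< n d
sauer-shelah {d = zero} P vc = ≤-reflexive (size-empty (VC<0⇒empty vc))
sauer-shelah {zero} {suc d} P vc with P []
... | true  = ≤-refl
... | false = z≤n
sauer-shelah {suc n} {suc d} P vc = subst (_≤ binom< n (suc d) + binom< n d) (sym (size-project-link zero P))
  (+-mono-≤ (sauer-shelah (project zero P) (VC<-project zero vc)) (sauer-shelah (link zero P) (VC<-link zero vc)))

-- A maximal family of VC dimension `k` has parameter `d = suc k` here.
Maximum : ℕ → Indicator n → Set
Maximum {n} d P = VC< d P × size P ≡ binom< n d

Maximum-split : ∀ i → Maximum (suc d) P → Maximum (suc d) (project i P) × Maximum d (link i P)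
Maximum-split {P = P} i (vc , eq)
  with p , l ← +-tight (sauer-shelah (project i P) (VC<-project i vc)) (sauer-shelah (link i P) (VC<-link i vc))
                       (trans (sym (size-project-link i P)) eq)
  = (VC<-project i vc , p) , (VC<-link i vc , l)

Maximum-project : ∀ {n d} {P : Indicator (suc n)} i → Maximum d P → Maximum d (project i P)
Maximum-project {d = zero} {P = P} i (vc , eq) =
  VC<-project i vc , m+n≡0⇒m≡0 (size (project i P)) (trans (sym (size-project-link i P)) eq)
Maximum-project {d = suc d} i max = proj₁ (Maximum-split i max)

-- Edges of the cube and lifting of paths

flip : Fin n → Subset n → Subset n
flip i x = updateAt x i not

Step : Indicator n → Subset n → Subset n → Set
Step P x y = (∃ λ i → y ≡ flip i x) × P y ≡ true

Path : Indicator n → Subset n → Subset n → Set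
Path P = Star (Step P)

insertAt-lookup-flip : ∀ (x : Subset (suc n)) i → insertAt (removeAt x i) i (not (Vec.lookup x i)) ≡ flip i x
insertAt-lookup-flip (b ∷ x)     zero    = refl
insertAt-lookup-flip (b ∷ c ∷ x) (suc i) = cong (b ∷_) (insertAt-lookup-flip (c ∷ x) i)

-- The link of the projection equals the projection of the link, since the latter is contained in
-- the former and both are maximum for the same parameters.
lift-edge : ∀ {n d} {P : Indicator (suc n)} → Maximum d P → ∀ i {x} →
  project zero P x ≡ true → project zero P (flip i x) ≡ true →
  ∃ λ b → P (b ∷ x) ≡ true × P (b ∷ flip i x) ≡ true
lift-edge {d = zero} {P = P} (vc , _) i px _ with b , pb ← ∈-project⁻ {P = P} zero px =
  contradiction pb (VC<0⇒empty vc _)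
lift-edge {n = suc n} {d = suc d} {P = P} max i {x} px py =
  b , subst (λ z → P (b ∷ z) ≡ true) (insertAt-removeAt x i) (∈-link⁻ {P = P} (suc i) (b ∷ removeAt x i) pb _)
    , subst (λ z → P (b ∷ z) ≡ true) (insertAt-lookup-flip x i) (∈-link⁻ {P = P} (suc i) (b ∷ removeAt x i) pb _)
  where
  PL LP : Indicator n
  PL = project zero (link (suc i) P)
  LP = link i (project zero P)
  PL⊑LP : PL ⊑ LP
  PL⊑LP r pr with b , pb ← ∈-project⁻ {P = link (suc i) P} zero pr =
    ∈-link⁺ {P = project zero P} i λ c → ∈-project⁺ {P = P} zero b (∈-link⁻ {P = P} (suc i) (b ∷ r) pb c)
  same-size : size PL ≡ size LP
  same-size = trans (proj₂ (Maximum-project zero (proj₂ (Maximum-split (suc i) max))))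
    (sym (proj₂ (proj₂ (Maximum-split i (Maximum-project zero max)))))
  r∈LP : LP (removeAt x i) ≡ true
  r∈LP = ∈-link⁺ {P = project zero P} i both
    where
    here′ : project zero P (insertAt (removeAt x i) i (Vec.lookup x i)) ≡ true
    here′ = subst (λ z → project zero P z ≡ true) (sym (insertAt-removeAt x i)) px
    there′ : project zero P (insertAt (removeAt x i) i (not (Vec.lookup x i))) ≡ true
    there′ = subst (λ z → project zero P z ≡ true) (sym (insertAt-lookup-flip x i)) py
    both : ∀ c → project zero P (insertAt (removeAt x i) i c) ≡ true
    both c with Vec.lookup x i | here′ | there′
    both false | false | h | t = h
    both false | true  | h | t = t
    both true  | false | h | t = t
    both true  | true  | h | t = h
  -- Membership in the projected link yields a single value `b` at coordinate zero over which both
  -- ends of the edge are present.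
  lifted : ∃ λ b → link (suc i) P (b ∷ removeAt x i) ≡ true
  lifted = ∈-project⁻ {P = link (suc i) P} zero (⊑-size-≡ PL⊑LP same-size (removeAt x i) r∈LP)
  b  = proj₁ lifted
  pb = proj₂ lifted

-- Induction on `n`: a path in the projection along coordinate zero is lifted edge by edge.
-- Consecutive lifts may disagree at coordinate zero; `switch` repairs this by an edge inside the
-- fibre.
Maximum⇒connected : ∀ {n d} {P : Indicator n} → Maximum d P → ∀ {x y} → P x ≡ true → P y ≡ true → Path P x y
Maximum⇒connected {n = zero}  max {[]} {[]} px py = ε
Maximum⇒connected {n = suc n} {P = P} max {b ∷ x} {c ∷ y} px py =
  lift (Maximum⇒connected (Maximum-project zero max) (∈-project⁺ {P = P} zero b px) (∈-project⁺ {P = P} zero c py)) px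
  where
  switch : ∀ {a e z} → P (a ∷ z) ≡ true → P (e ∷ z) ≡ true → Path P (a ∷ z) (e ∷ z)
  switch {false} {false} pa pe = ε
  switch {false} {true}  pa pe = ((zero , refl) , pe) ◅ ε
  switch {true}  {false} pa pe = ((zero , refl) , pe) ◅ ε
  switch {true}  {true}  pa pe = ε
  lift : ∀ {a z} → Path (project zero P) z y → P (a ∷ z) ≡ true → Path P (a ∷ z) (c ∷ y)
  lift ε pa = switch pa py
  lift {a} (((i , refl) , pz) ◅ path) pa with e , pe , pf ← lift-edge max i (∈-project⁺ {P = P} zero a pa) pz =
    switch pa pe ◅◅ (((suc i , refl) , pf) ◅ lift path pf)

-- Encoding connected families

_≟ˢ_ : (x y : Subset n) → Dec (x ≡ y)
_≟ˢ_ = ≡-dec _≟ᵇ_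



_∈?_ : (x : Subset n) (F : Family n) → Dec (x ∈ F)
_∈?_ = DecMembership._∈?_ _≟ˢ_

-- Counting with duplicate-free lists and sublists

length-cartesianProductWith : ∀ {b c} {B : Set b} {C : Set c} (f : A → B → C) xs ys →
  length (cartesianProductWith f xs ys) ≡ length xs * length ys
length-cartesianProductWith f []       ys = refl
length-cartesianProductWith f (x ∷ xs) ys = trans (length-++ (map (f x) ys))
  (cong₂ _+_ (length-map (f x) ys) (length-cartesianProductWith f xs ys))

-- Each element of `xs` is struck from `ys` in turn, and uniqueness keeps the later ones in place.
-- Both bounds on `m` count through this.
length-⊆ : {xs ys : List A} → Unique xs → xs ⊆ ys → length xs ≤ length ys
length-⊆ {xs = []} _ _ = z≤n
length-⊆ {xs = x ∷ xs} (x∉xs ∷ u) sub with as , bs , refl ← ∈-∃++ (sub (here refl)) = begin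
  suc (length xs)               ≤⟨ s≤s (length-⊆ u rest) ⟩
  suc (length (as ++ bs))       ≡⟨ cong suc (length-++ as) ⟩
  suc (length as + length bs)   ≡⟨ +-suc (length as) (length bs) ⟨
  length as + suc (length bs)   ≡⟨ length-++ as ⟨
  length (as ++ x ∷ bs)         ∎
  where
  open ≤-Reasoning
  rest : xs ⊆ as ++ bs
  rest y∈xs with ∈-++⁻ as (sub (there y∈xs))
  ... | inj₁ y∈as          = ∈-++⁺ˡ y∈as
  ... | inj₂ (here refl)   = contradiction refl (All.lookup x∉xs y∈xs)
  ... | inj₂ (there y∈bs)  = ∈-++⁺ʳ as y∈bs

missing-element : {F L : Family n} → Unique F → length L < length F → ∃ λ y → y ∈ F × y ∉ L
missing-element {F = F} {L} u L<F with All.all? (_∈? L) F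
... | yes F⊆L = contradiction (length-⊆ u (All.lookup F⊆L)) (<⇒≱ L<F)
... | no  F⊈L = find (¬All⇒Any¬ (_∈? L) F F⊈L)

length-filter-map : ∀ {b p} {B : Set b} {P : A → Set p} (P? : Decidable P) (f : B → A) xs →
  length (filter P? (map f xs)) ≡ length (filter (P? ∘ f) xs)
length-filter-map P? f [] = refl
length-filter-map P? f (x ∷ xs) with does (P? (f x))
... | true  = cong suc (length-filter-map P? f xs)
... | false = length-filter-map P? f xs

size-filter : ∀ {p} {P : Subset n → Set p} (P? : Decidable P) →
  length (filter P? (allSubsets n)) ≡ size (does ∘ P?)
size-filter {zero} P? with does (P? [])
... | true  = refl
... | false = refl
size-filter {suc n} P? = begin
  length (filter P? (map (outside ∷_) all ++ map (inside ∷_) all))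
    ≡⟨ cong length (filter-++ P? (map (outside ∷_) all) _) ⟩
  length (filter P? (map (outside ∷_) all) ++ filter P? (map (inside ∷_) all))
    ≡⟨ length-++ (filter P? (map (outside ∷_) all)) ⟩
  length (filter P? (map (outside ∷_) all)) + length (filter P? (map (inside ∷_) all))
    ≡⟨ cong₂ _+_ (length-filter-map P? (outside ∷_) all) (length-filter-map P? (inside ∷_) all) ⟩
  length (filter (P? ∘ (outside ∷_)) all) + length (filter (P? ∘ (inside ∷_)) all)
    ≡⟨ cong₂ _+_ (size-filter (P? ∘ (outside ∷_))) (size-filter (P? ∘ (inside ∷_))) ⟩
  size (does ∘ P?) ∎
  where
  open ≡-Reasoning
  all = allSubsets n

∈-allSubsets : (x : Subset n) → x ∈ allSubsets n
∈-allSubsets [] = here refl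
∈-allSubsets (false ∷ x) = ∈-++⁺ˡ (∈-map⁺ (outside ∷_) (∈-allSubsets x))
∈-allSubsets {suc n} (true ∷ x) = ∈-++⁺ʳ (map (outside ∷_) (allSubsets n)) (∈-map⁺ (inside ∷_) (∈-allSubsets x))

allSubsets-unique : ∀ n → Unique (allSubsets n)
allSubsets-unique zero    = [] ∷ []
allSubsets-unique (suc n) = Unique.++⁺
  (Unique.map⁺ ∷-injectiveʳ (allSubsets-unique n)) (Unique.map⁺ ∷-injectiveʳ (allSubsets-unique n))
  λ (v∈out , v∈in) → different (proj₂ (proj₂ (∈-map⁻ (outside ∷_) v∈out))) (proj₂ (proj₂ (∈-map⁻ (inside ∷_) v∈in)))
  where
  different : ∀ {v x y} → v ≡ outside ∷ x → v ≢ inside ∷ y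
  different refl ()

length-allSubsets : ∀ n → length (allSubsets n) ≡ 2 ^ n
length-allSubsets zero    = refl
length-allSubsets (suc n) = begin
  length (map (outside ∷_) (allSubsets n) ++ map (inside ∷_) (allSubsets n))
    ≡⟨ length-++ (map (outside ∷_) (allSubsets n)) ⟩
  length (map (outside ∷_) (allSubsets n)) + length (map (inside ∷_) (allSubsets n))
    ≡⟨ cong₂ _+_ (length-map (outside ∷_) (allSubsets n))
         (trans (length-map (inside ∷_) (allSubsets n)) (sym (+-identityʳ _))) ⟩
  2 * length (allSubsets n)
    ≡⟨ cong (2 *_) (length-allSubsets n) ⟩
  2 ^ suc n ∎
  where open ≡-Reasoning

sublists-⊆ : {xs ys : List A} → ys ∈ sublists xs → ys ⊆ xs
sublists-⊆ {xs = []} (here refl) ()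
sublists-⊆ {xs = x ∷ xs} ys∈ y∈ys with ∈-++⁻ (sublists xs) ys∈
... | inj₁ old = there (sublists-⊆ old y∈ys)
... | inj₂ new with zs , zs∈ , refl ← ∈-map⁻ (x ∷_) new with y∈ys
...   | here refl   = here refl
...   | there y∈zs  = there (sublists-⊆ zs∈ y∈zs)

sublists-unique : {xs : List A} → Unique xs → Unique (sublists xs)
sublists-unique [] = [] ∷ []
sublists-unique {xs = x ∷ xs} u@(_ ∷ u′) = Unique.++⁺ (sublists-unique u′)
  (Unique.map⁺ (λ { refl → refl }) (sublists-unique u′))
  λ (old , new) → Unique.Unique[x∷xs]⇒x∉xs u (x∈xs old (proj₂ (proj₂ (∈-map⁻ (x ∷_) new))))
  where
  x∈xs : ∀ {ys zs} → ys ∈ sublists xs → ys ≡ x ∷ zs → x ∈ xs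
  x∈xs ys∈ refl = sublists-⊆ ys∈ (here refl)

filter-∈-sublists : ∀ {p} {P : A → Set p} (P? : Decidable P) xs → filter P? xs ∈ sublists xs
filter-∈-sublists P? [] = here refl
filter-∈-sublists P? (x ∷ xs) with does (P? x)
... | true  = ∈-++⁺ʳ (sublists xs) (∈-map⁺ (x ∷_) (filter-∈-sublists P? xs))
... | false = ∈-++⁺ˡ (filter-∈-sublists P? xs)

sublist-unique : {xs ys : List A} → Unique xs → ys ∈ sublists xs → Unique ys
sublist-unique {xs = []} u (here refl) = []
sublist-unique {xs = x ∷ xs} u@(_ ∷ u′) ys∈ with ∈-++⁻ (sublists xs) ys∈
... | inj₁ old = sublist-unique u′ old
... | inj₂ new with zs , zs∈ , refl ← ∈-map⁻ (x ∷_) new =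
  All.tabulate (λ {z} z∈zs x≡z → Unique.Unique[x∷xs]⇒x∉xs u (subst (_∈ xs) (sym x≡z) (sublists-⊆ zs∈ z∈zs)))
  ∷ sublist-unique u′ zs∈

filter-cong-∈ : ∀ {p q} {P : A → Set p} {Q : A → Set q} (P? : Decidable P) (Q? : Decidable Q) {xs} →
  (∀ {x} → x ∈ xs → P x ⇔ Q x) → filter P? xs ≡ filter Q? xs
filter-cong-∈ P? Q? {[]} P⇔Q = refl
filter-cong-∈ P? Q? {x ∷ xs} P⇔Q with P? x | Q? x
... | yes _ | yes _ = cong (x ∷_) (filter-cong-∈ P? Q? (P⇔Q ∘ there))
... | no _  | no _  = filter-cong-∈ P? Q? (P⇔Q ∘ there)
... | yes p | no ¬q = contradiction (to (P⇔Q (here refl)) p) ¬q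
... | no ¬p | yes q = contradiction (from (P⇔Q (here refl)) q) ¬p

-- A sublist keeps the order of `xs`, so its members alone determine it. Families with the same
-- members are thus equal as lists.
sublist≡filter : {xs ys : Family n} → Unique xs → ys ∈ sublists xs → ys ≡ filter (_∈? ys) xs
sublist≡filter {xs = []} u (here refl) = refl
sublist≡filter {xs = x ∷ xs} u@(_ ∷ u′) ys∈ with ∈-++⁻ (sublists xs) ys∈
... | inj₁ old = trans (sublist≡filter u′ old)
  (sym (filter-reject (_∈? _) (Unique.Unique[x∷xs]⇒x∉xs u ∘ sublists-⊆ old)))
... | inj₂ new with zs , zs∈ , refl ← ∈-map⁻ (x ∷_) new = begin
  x ∷ zs                          ≡⟨ cong (x ∷_) (sublist≡filter u′ zs∈) ⟩
  x ∷ filter (_∈? zs) xs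
    ≡⟨ cong (x ∷_) (filter-cong-∈ (_∈? zs) (_∈? (x ∷ zs)) (λ w∈ → mk⇔ there (drop-x w∈))) ⟩
  x ∷ filter (_∈? (x ∷ zs)) xs    ≡⟨ filter-accept (_∈? (x ∷ zs)) (here refl) ⟨
  filter (_∈? (x ∷ zs)) (x ∷ xs)  ∎
  where
  open ≡-Reasoning
  drop-x : ∀ {w} → w ∈ xs → w ∈ x ∷ zs → w ∈ zs
  drop-x w∈xs (here refl) = contradiction w∈xs (Unique.Unique[x∷xs]⇒x∉xs u)
  drop-x w∈xs (there w∈)  = w∈

-- Traversal words and their number

Code : ℕ → Set
Code n = List (Maybe (Fin n))

-- A depth-first traversal: just i moves from v to flip i v, nothing backtracks along the stack.
explore : Code n → Subset n → List (Subset n) → List (Subset n)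
explore []            v st       = []
explore (nothing ∷ c) v []       = explore c v []
explore (nothing ∷ c) v (u ∷ st) = explore c u st
explore (just i ∷ c)  v st       = flip i v ∷ explore c (flip i v) (v ∷ st)

moves backtracks : Code n → ℕ
moves []            = 0
moves (just i ∷ c)  = suc (moves c)
moves (nothing ∷ c) = moves c
backtracks []            = 0
backtracks (just i ∷ c)  = backtracks c
backtracks (nothing ∷ c) = suc (backtracks c)

length-explore : (c : Code n) → ∀ v st → length (explore c v st) ≡ moves c
length-explore []            v st       = refl
length-explore (nothing ∷ c) v []       = length-explore c v []
length-explore (nothing ∷ c) v (u ∷ st) = length-explore c u st
length-explore (just i ∷ c)  v st       = cong suc (length-explore c (flip i v) (v ∷ st))

-- Insert the detour (just i, nothing) at the first visit of x.
extend : ∀ (c : Code n) v st i {x} → x ∈ v ∷ explore c v st → ∃ λ c′ →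
  moves c′ ≡ suc (moves c) × backtracks c′ ≡ suc (backtracks c) × explore c′ v st ↭ flip i x ∷ explore c v st
extend c v st i (here refl) = just i ∷ nothing ∷ c , refl , refl , ↭-refl
extend (nothing ∷ c) v [] i (there x∈) with c′ , m , b , p ← extend c v [] i (there x∈) =
  nothing ∷ c′ , m , cong suc b , p
extend (nothing ∷ c) v (u ∷ st) i (there x∈) with c′ , m , b , p ← extend c u st i (there x∈) =
  nothing ∷ c′ , m , cong suc b , p
extend (just j ∷ c) v st i (there x∈) with c′ , m , b , p ← extend c (flip j v) (v ∷ st) i x∈ =
  just j ∷ c′ , cong suc m , b , ↭-trans (prep _ p) (swap _ _ ↭-refl)

codes : ℕ → ℕ → List (Code n)
codes zero    zero    = [] ∷ []
codes zero    (suc b) = map (nothing ∷_) (codes zero b)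
codes (suc a) zero    = cartesianProductWith List._∷_ (map just (allFin _)) (codes a zero)
codes (suc a) (suc b) = cartesianProductWith List._∷_ (map just (allFin _)) (codes a (suc b))
  ++ map (nothing ∷_) (codes (suc a) b)

∈-codes : (c : Code n) → c ∈ codes (moves c) (backtracks c)
∈-codes [] = here refl
∈-codes (just i ∷ c) with backtracks c | ∈-codes c
... | zero  | c∈ = ∈-cartesianProductWith⁺ List._∷_ (∈-map⁺ just (∈-allFin i)) c∈
... | suc b | c∈ = ∈-++⁺ˡ (∈-cartesianProductWith⁺ List._∷_ (∈-map⁺ just (∈-allFin i)) c∈)
∈-codes (nothing ∷ c) with moves c | ∈-codes c
... | zero  | c∈ = ∈-map⁺ (nothing ∷_) c∈
... | suc a | c∈ = ∈-++⁺ʳ (cartesianProductWith List._∷_ (map just (allFin _)) (codes a (suc (backtracks c))))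
  (∈-map⁺ (nothing ∷_) c∈)

length-moves : ∀ n (cs : List (Code n)) →
  length (cartesianProductWith List._∷_ (map just (allFin n)) cs) ≡ n * length cs
length-moves n cs = trans (length-cartesianProductWith List._∷_ (map just (allFin n)) cs)
  (cong (_* length cs) (trans (length-map just (allFin n)) (length-tabulate {n = n} id)))

-- There are at most `2 ^ (a + b)` patterns of moves and backtracks, and each move has `n`
-- directions. When both letters are available, each choice of the first letter accounts for half of
-- the bound.
length-codes : ∀ n a b → length (codes {n} a b) ≤ 2 ^ (a + b) * n ^ a
length-codes n zero zero = ≤-refl
length-codes n zero (suc b) = begin
  length (map (nothing ∷_) (codes {n} zero b))  ≡⟨ length-map _ (codes zero b) ⟩
  length (codes {n} zero b)                     ≤⟨ length-codes n zero b ⟩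
  2 ^ b * 1                                     ≤⟨ *-monoˡ-≤ 1 (m≤m+n (2 ^ b) _) ⟩
  2 ^ suc b * 1                                 ∎
  where open ≤-Reasoning
length-codes n (suc a) zero = begin
  length (codes {n} (suc a) zero)               ≡⟨ length-moves n (codes a zero) ⟩
  n * length (codes {n} a zero)                 ≤⟨ *-monoʳ-≤ n (length-codes n a zero) ⟩
  n * (2 ^ (a + 0) * n ^ a)
    ≡⟨ solve 3 (λ x y z → x :* (y :* z) := y :* (x :* z)) refl n (2 ^ (a + 0)) (n ^ a) ⟩
  2 ^ (a + 0) * n ^ suc a                       ≤⟨ *-monoˡ-≤ (n ^ suc a) (m≤m+n (2 ^ (a + 0)) _) ⟩
  2 ^ suc (a + 0) * n ^ suc a                   ∎
  where
  open ≤-Reasoning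
  open +-*-Solver
length-codes n (suc a) (suc b) = begin
  length (codes {n} (suc a) (suc b))
    ≡⟨ length-++ (cartesianProductWith List._∷_ (map just (allFin n)) (codes a (suc b))) ⟩
  length (cartesianProductWith List._∷_ (map just (allFin n)) (codes a (suc b)))
    + length (map (nothing ∷_) (codes {n} (suc a) b))
    ≡⟨ cong₂ _+_ (length-moves n (codes a (suc b))) (length-map (nothing ∷_) (codes (suc a) b)) ⟩
  n * length (codes {n} a (suc b)) + length (codes {n} (suc a) b)
    ≤⟨ +-mono-≤ (*-monoʳ-≤ n (length-codes n a (suc b))) (length-codes n (suc a) b) ⟩
  n * (2 ^ (a + suc b) * n ^ a) + 2 ^ (suc a + b) * (n * n ^ a)
    ≡⟨ cong (λ e → n * (2 ^ (a + suc b) * n ^ a) + 2 ^ e * (n * n ^ a)) (+-suc a b) ⟨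
  n * (2 ^ (a + suc b) * n ^ a) + 2 ^ (a + suc b) * (n * n ^ a)
    ≡⟨ solve 3 (λ x y z → x :* (y :* z) :+ y :* (x :* z) := (y :+ (y :+ con 0)) :* (x :* z)) refl n (2 ^ (a + suc b)) (n ^ a) ⟩
  2 ^ (suc a + suc b) * n ^ suc a ∎
  where
  open ≤-Reasoning
  open +-*-Solver

Connected : Family n → Set
Connected F = ∀ {x y} → x ∈ F → y ∈ F → Star (λ x y → (∃ λ i → y ≡ flip i x) × y ∈ F) x y

-- The path is followed up to its first step out of `L`.
boundary-edge : {F L : Family n} → ∀ {x y} → Star (λ x y → (∃ λ i → y ≡ flip i x) × y ∈ F) x y →
  x ∈ L → y ∉ L → ∃ λ z → ∃ λ i → z ∈ L × flip i z ∈ F × flip i z ∉ L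
boundary-edge ε x∈L y∉L = contradiction x∈L y∉L
boundary-edge {L = L} {x} (((i , refl) , z∈F) ◅ path) x∈L y∉L with flip i x ∈? L
... | yes z∈L = boundary-edge path z∈L y∉L
... | no  z∉L = x , i , x∈L , z∈F , z∉L

-- The explored part grows by one vertex at a time: while it misses a point of `F`, connectivity
-- gives an edge leaving it, and `extend` inserts a detour along that edge. As the start counts too,
-- `t` moves visit `suc t` vertices.
spanning-code : {F : Family n} → Unique F → Connected F → ∀ {v} → v ∈ F → ∀ t → t < length F →
  ∃ λ c → moves c ≡ t × backtracks c ≡ t × Unique (v ∷ explore c v []) × (v ∷ explore c v []) ⊆ F
spanning-code u conn v∈F zero _ = [] , refl , refl , [] ∷ [] , λ { (here refl) → v∈F }
spanning-code {F = F} u conn {v} v∈F (suc t) t<F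
  with c , m , b , uniq , sub ← spanning-code u conn v∈F t (<⇒≤ t<F)
  with y , y∈F , y∉L ← missing-element {L = v ∷ explore c v []} u
         (subst (λ l → suc l < length F) (sym (trans (length-explore c v []) m)) t<F)
  with x , i , x∈L , z∈F , z∉L ← boundary-edge {L = v ∷ explore c v []} (conn v∈F y∈F) (here refl) y∉L
  with c′ , m′ , b′ , perm ← extend c v [] i x∈L
  = c′ , trans m′ (cong suc m) , trans b′ (cong suc b)
  , Unique-resp-↭ (setoid _) (↭⇒↭ₛ (↭-sym perm′)) (¬Any⇒All¬ _ z∉L ∷ uniq)
  , λ w∈ → ⊆F (∈-resp-↭ perm′ w∈)
  where
  perm′ : v ∷ explore c′ v [] ↭ flip i x ∷ v ∷ explore c v []
  perm′ = ↭-trans (prep v perm) (swap _ _ ↭-refl)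
  ⊆F : flip i x ∷ v ∷ explore c v [] ⊆ F
  ⊆F (here refl) = z∈F
  ⊆F (there w∈)  = sub w∈

-- Filtering `allSubsets` forgets the order of the traversal and restores the canonical order of a
-- family.
decode : Subset n → Code n → Family n
decode {n} v c = filter (_∈? (v ∷ explore c v [])) (allSubsets n)

-- A code with `t` moves already visits `suc t` distinct members, so a member left out would be one
-- too many.
connected-decode : {F : Family n} → F ∈ sublists (allSubsets n) → Connected F → ∀ {t} → length F ≡ suc t →
  F ∈ cartesianProductWith decode (allSubsets n) (codes t t)
connected-decode {n} {F@(v ∷ _)} F∈ conn {t} len
  with c , m , b , uniq , sub ← spanning-code (sublist-unique (allSubsets-unique n) F∈) conn (here refl) t
         (≤-reflexive (sym len))
  = subst (_∈ _) (sym F≡decode) (∈-cartesianProductWith⁺ decode (∈-allSubsets v)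
      (subst₂ (λ a b → c ∈ codes a b) m b (∈-codes c)))
  where
  covers : F ⊆ v ∷ explore c v []
  covers {y} y∈F with y ∈? (v ∷ explore c v [])
  ... | yes y∈L = y∈L
  ... | no  y∉L = contradiction (length-⊆ (¬Any⇒All¬ _ y∉L ∷ uniq) λ { (here refl) → y∈F ; (there w∈) → sub w∈ })
    (<⇒≱ (s≤s (≤-reflexive (trans len (cong suc (sym (trans (length-explore c v []) m)))))))
  F≡decode : F ≡ decode v c
  F≡decode = trans (sublist≡filter (allSubsets-unique n) F∈)
    (filter-≐ (_∈? F) (_∈? (v ∷ explore c v [])) (covers , sub) (allSubsets n))

-- Agreement with the Boolean definitions

T-not : ∀ {b} → T (not b) → ¬ T b
T-not {true} ()

not-T : ∀ {b} → ¬ T b → T (not b)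
not-T {true}  ¬t = ¬t _
not-T {false} ¬t = _

indicator : Family n → Indicator n
indicator F x = does (x ∈? F)

∈⇒indicator : {F : Family n} → ∀ {x} → x ∈ F → indicator F x ≡ true
∈⇒indicator {F = F} {x} x∈F = dec-true (x ∈? F) x∈F

indicator⇒∈ : {F : Family n} → ∀ {x} → indicator F x ≡ true → x ∈ F
indicator⇒∈ {F = F} {x} eq with yes x∈F ← x ∈? F = x∈F

==-refl : (x : Subset n) → T (x == x)
==-refl []          = _
==-refl (true ∷ x)  = ==-refl x
==-refl (false ∷ x) = ==-refl x

==⇒≡ : (x y : Subset n) → T (x == y) → x ≡ y
==⇒≡ []          []          _  = refl
==⇒≡ (true ∷ x)  (true ∷ y)  eq = cong (true ∷_) (==⇒≡ x y eq)
==⇒≡ (false ∷ x) (false ∷ y) eq = cong (false ∷_) (==⇒≡ x y eq)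

⊆⇒∩≡ : {A S : Subset n} → A ⊆ˢ S → A ∩ S ≡ A
⊆⇒∩≡ {A = A} {S} A⊆S = ⊆-antisym (p∩q⊆p A S) (λ x∈A → x∈p∩q⁺ (x∈A , A⊆S x∈A))

shatters⇒Shatters : (F : Family n) (S : Subset n) → T (shatters F S) → Shatters (indicator F) S
shatters⇒Shatters {n} F S sh A
  with B , B∈F , eq ← find (any⁻ (λ B → (B ∩ S) == (A ∩ S)) F
         (All.lookup (all⁺ _ _ sh) (∈-filter⁺ (_⊆? S) (∈-allSubsets (A ∩ S)) (p∩q⊆q A S))))
  = B , ∈⇒indicator B∈F , ==⇒≡ (B ∩ S) (A ∩ S) eq

Shatters⇒shatters : (F : Family n) (S : Subset n) → Shatters (indicator F) S → T (shatters F S)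
Shatters⇒shatters {n} F S sh = all⁻ _ (All.tabulate λ {A} A∈ → any⁺ (λ B → (B ∩ S) == A) (pattern-hit A A∈))
  where
  pattern-hit : ∀ A → A ∈ filter (_⊆? S) (allSubsets n) → Any (λ B → T ((B ∩ S) == A)) F
  pattern-hit A A∈ with B , B∈F , eq ← sh A = lose (indicator⇒∈ B∈F)
    (subst (λ Y → T (Y == A)) (sym (trans eq (⊆⇒∩≡ (proj₂ (∈-filter⁻ (_⊆? S) {xs = allSubsets n} A∈))))) (==-refl A))

-- Pascal's rule turns the recursion on `n` into a sum over layers, which identifies `binom<` with
-- `binom≤`.
binom<-suc : ∀ n d → binom< n (suc d) ≡ binom< n d + n C d
binom<-suc zero    zero    = refl
binom<-suc zero    (suc d) = refl
binom<-suc (suc n) zero    = trans (cong (_+ 0) (binom<-suc n zero)) refl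
binom<-suc (suc n) (suc d) = begin
  binom< n (2 + d) + binom< n (suc d)
    ≡⟨ cong₂ _+_ (binom<-suc n (suc d)) (binom<-suc n d) ⟩
  (binom< n (suc d) + n C suc d) + (binom< n d + n C d)
    ≡⟨ interchange (binom< n (suc d)) (n C suc d) (binom< n d) (n C d) ⟩
  (binom< n (suc d) + binom< n d) + (n C suc d + n C d)
    ≡⟨ cong (binom< (suc n) (suc d) +_) (trans (+-comm (n C suc d) (n C d)) (nCk+nC[k+1]≡[n+1]C[k+1] n d)) ⟩
  binom< (suc n) (suc d) + suc n C suc d ∎
  where open ≡-Reasoning

binom≤≡binom< : ∀ n k → binom≤ n k ≡ binom< n (suc k)
binom≤≡binom< n zero    = sym (binom<-suc n zero)
binom≤≡binom< n (suc k) = trans (cong (_+ n C suc k) (binom≤≡binom< n k)) (sym (binom<-suc n (suc k)))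

hasVC⇔ : (F : Family n) (k : ℕ) →
  T (hasVC F k) ⇔ ((∃ λ S → ∣ S ∣ ≡ k × Shatters (indicator F) S) × VC< (suc k) (indicator F))
hasVC⇔ {n} F k = mk⇔ fwd bwd
  where
  fwd : T (hasVC F k) → _
  fwd vc with ex , bd ← to T-∧ vc = witness (find (any⁻ _ (allSubsets n) ex)) , bound
    where
    witness : (∃ λ S → S ∈ allSubsets n × T ((∣ S ∣ ≡ᵇ k) ∧ shatters F S)) → _
    witness (S , _ , p) with e , sh ← to T-∧ p = S , ≡ᵇ⇒≡ ∣ S ∣ k e , shatters⇒Shatters F S sh
    bound : VC< (suc k) (indicator F)
    bound S sh = ≰⇒> λ k<S → T-not bd (any⁺ _ (lose (∈-allSubsets S)
      (from T-∧ (≤⇒≤ᵇ k<S , Shatters⇒shatters F S sh))))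
  bwd : _ → T (hasVC F k)
  bwd ((S , e , sh) , vc) = from T-∧
    ( any⁺ _ (lose (∈-allSubsets S) (from T-∧ (≡⇒≡ᵇ ∣ S ∣ k e , Shatters⇒shatters F S sh)))
    , not-T λ t → large (find (any⁻ _ (allSubsets n) t)))
    where
    large : ¬ (∃ λ S → S ∈ allSubsets n × T ((suc k ≤ᵇ ∣ S ∣) ∧ shatters F S))
    large (S , _ , p) with k<S , sh ← to T-∧ p =
      <⇒≱ (vc S (shatters⇒Shatters F S sh)) (≤ᵇ⇒≤ (suc k) ∣ S ∣ k<S)

size-indicator : {F : Family n} → F ∈ sublists (allSubsets n) → size (indicator F) ≡ length F
size-indicator {n} {F} F∈ = trans (sym (size-filter (_∈? F)))
  (cong length (sym (sublist≡filter (allSubsets-unique n) F∈)))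

maximal⇒connected : ∀ {k} {F : Family n} → F ∈ sublists (allSubsets n) → isMaximalVC F k ≡ true →
  Connected F × length F ≡ binom≤ n k
maximal⇒connected {n} {k} {F} F∈ eq with vc , len ← to T-∧ (from T-≡ eq) = connected , length≡
  where
  length≡ = ≡ᵇ⇒≡ (length F) (binom≤ n k) len
  maximum : Maximum (suc k) (indicator F)
  maximum = proj₂ (to (hasVC⇔ F k) vc) , trans (size-indicator F∈) (trans length≡ (binom≤≡binom< n k))
  connected : Connected F
  connected x∈F y∈F = Star.map (λ (edge , y∈) → edge , indicator⇒∈ y∈)
    (Maximum⇒connected maximum (∈⇒indicator x∈F) (∈⇒indicator y∈F))

-- The factors count the start points, the interleavings of `t` moves with `t` backtracks, and the
-- directions of the moves.
m-upper : ∀ n k t → binom≤ n k ≡ suc t → m n k ≤ 2 ^ n * (2 ^ (t + t) * n ^ t)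
m-upper n k t B≡ = begin
  m n k
    ≤⟨ length-⊆ (Unique.filter⁺ maximal? (sublists-unique (allSubsets-unique n))) encodable ⟩
  length (cartesianProductWith decode (allSubsets n) (codes t t))
    ≡⟨ length-cartesianProductWith decode (allSubsets n) (codes t t) ⟩
  length (allSubsets n) * length (codes {n} t t)
    ≤⟨ *-mono-≤ (≤-reflexive (length-allSubsets n)) (length-codes n t t) ⟩
  2 ^ n * (2 ^ (t + t) * n ^ t) ∎
  where
  open ≤-Reasoning
  maximal? : Decidable (λ F → isMaximalVC F k ≡ true)
  maximal? F = isMaximalVC F k ≟ᵇ true
  encodable : filter maximal? (sublists (allSubsets n)) ⊆ cartesianProductWith decode (allSubsets n) (codes t t)
  encodable F∈m with F∈ , max ← ∈-filter⁻ maximal? {xs = sublists (allSubsets n)} F∈m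
    with conn , len ← maximal⇒connected F∈ max = connected-decode F∈ conn (trans len B≡)

-- Families close to a Hamming ball

family : Indicator n → Family n
family {n} P = filter (λ x → P x ≟ᵇ true) (allSubsets n)

family⊑ : indicator (family P) ⊑ P
family⊑ {P = P} x x∈ = proj₂ (∈-filter⁻ (λ x → P x ≟ᵇ true) {xs = allSubsets _} (indicator⇒∈ x∈))

⊑family : P ⊑ indicator (family P)
⊑family {P = P} x px = ∈⇒indicator {F = family P} (∈-filter⁺ (λ x → P x ≟ᵇ true) (∈-allSubsets x) px)

length-family : (P : Indicator n) → length (family P) ≡ size P
length-family P = trans (size-filter (λ x → P x ≟ᵇ true)) (size-cong λ x → does-≟-true (P x))
  where
  does-≟-true : ∀ b → does (b ≟ᵇ true) ≡ b
  does-≟-true true  = refl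
  does-≟-true false = refl

Shatters-mono : {P Q : Indicator n} → P ⊑ Q → ∀ {S} → Shatters P S → Shatters Q S
Shatters-mono P⊑Q sh A with B , pB , eq ← sh A = B , P⊑Q B pB , eq

family-maximal : {P : Indicator n} → (∃ λ S → ∣ S ∣ ≡ k × Shatters P S) → VC< (suc k) P →
  size P ≡ binom≤ n k → isMaximalVC (family P) k ≡ true
family-maximal {n} {k} {P} (S , ∣S∣≡k , sh) vc size≡ = to T-≡ (from T-∧
  ( from (hasVC⇔ (family P) k)
      ((S , ∣S∣≡k , Shatters-mono ⊑family sh) , λ S sh → vc S (Shatters-mono family⊑ sh))
  , ≡⇒≡ᵇ (length (family P)) (binom≤ n k) (trans (length-family P) size≡)))

-- Layers, balls and splitting of coordinates

size-layer : ∀ r k → size {r} (λ a → ∣ a ∣ ≡ᵇ k) ≡ r C k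
size-layer zero    zero    = refl
size-layer zero    (suc k) = refl
size-layer (suc r) zero    = cong₂ _+_ (size-layer r zero) (size-empty {r} λ _ ())
size-layer (suc r) (suc k) = trans (cong₂ _+_ (size-layer r (suc k)) (size-layer r k))
  (trans (+-comm (r C suc k) (r C k)) (nCk+nC[k+1]≡[n+1]C[k+1] r k))

size-ball : ∀ n d → size {n} (λ x → ∣ x ∣ <ᵇ d) ≡ binom< n d
size-ball zero    zero    = refl
size-ball zero    (suc d) = refl
size-ball (suc n) zero    = cong₂ _+_ (size-empty {n} λ _ ()) (size-empty {n} λ _ ())
size-ball (suc n) (suc d) = cong₂ _+_ (size-ball n (suc d)) (size-ball n d)

size-singleton : ∀ {n} {P : Indicator n} y → P y ≡ true → (∀ x → P x ≡ true → x ≡ y) → size P ≡ 1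
size-singleton {zero} [] py unique rewrite py = refl
size-singleton {suc n} (false ∷ y) py unique = cong₂ _+_
  (size-singleton y py λ x px → ∷-injectiveʳ (unique (false ∷ x) px))
  (size-empty λ x px → case unique (true ∷ x) px of λ ())
size-singleton {suc n} (true ∷ y) py unique = cong₂ _+_
  (size-empty λ x px → case unique (false ∷ x) px of λ ())
  (size-singleton y py λ x px → ∷-injectiveʳ (unique (true ∷ x) px))

size-fibres : ∀ r w (P Q : Indicator (r + w)) →
  (∀ (a : Subset r) → size {w} (λ x → P (a Vec.++ x)) ≡ size {w} (λ x → Q (a Vec.++ x))) → size P ≡ size Q
size-fibres zero    w P Q eq = eq []
size-fibres (suc r) w P Q eq = cong₂ _+_
  (size-fibres r w _ _ λ a → eq (false ∷ a)) (size-fibres r w _ _ λ a → eq (true ∷ a))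

∣++∣ : (a : Subset r) (x : Subset w) → ∣ a Vec.++ x ∣ ≡ ∣ a ∣ + ∣ x ∣
∣++∣ []          x = refl
∣++∣ (false ∷ a) x = ∣++∣ a x
∣++∣ (true ∷ a)  x = cong suc (∣++∣ a x)

∣x∣≡0⇒x≡⊥ : (x : Subset n) → ∣ x ∣ ≡ 0 → x ≡ ⊥
∣x∣≡0⇒x≡⊥ []          _  = refl
∣x∣≡0⇒x≡⊥ (false ∷ x) eq = cong (false ∷_) (∣x∣≡0⇒x≡⊥ x eq)

∣B∣≤∣B∩S∣⇒B∩S≡B : (B S : Subset n) → ∣ B ∣ ≤ ∣ B ∩ S ∣ → B ∩ S ≡ B
∣B∣≤∣B∩S∣⇒B∩S≡B []          []          _ = refl
∣B∣≤∣B∩S∣⇒B∩S≡B (false ∷ B) (s ∷ S)     le = cong (false ∷_) (∣B∣≤∣B∩S∣⇒B∩S≡B B S le)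
∣B∣≤∣B∩S∣⇒B∩S≡B (true ∷ B)  (true ∷ S)  le = cong (true ∷_) (∣B∣≤∣B∩S∣⇒B∩S≡B B S (s≤s⁻¹ le))
∣B∣≤∣B∩S∣⇒B∩S≡B (true ∷ B)  (false ∷ S) le = contradiction (≤-trans le (∣p∩q∣≤∣p∣ B S)) 1+n≰n

subset-of-size : ∀ {w k} → k ≤ w → ∃ λ (y : Subset w) → ∣ y ∣ ≡ k
subset-of-size {w}     z≤n = ⊥ , ∣⊥∣≡0 w
subset-of-size (s≤s k≤w) with y , eq ← subset-of-size k≤w = true ∷ y , cong suc eq

take-++ : (a : Subset r) (x : Subset w) → take r (a Vec.++ x) ≡ a
take-++ {r} a x = proj₁ (++-injective _ a (take++drop≡id r (a Vec.++ x)))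

drop-++ : (a : Subset r) (x : Subset w) → drop r (a Vec.++ x) ≡ x
drop-++ {r} a x = proj₂ (++-injective _ a (take++drop≡id r (a Vec.++ x)))

∩-++ : (X : Subset (r + w)) (s : Subset r) (y : Subset w) →
  X ∩ (s Vec.++ y) ≡ (take r X ∩ s) Vec.++ (drop r X ∩ y)
∩-++ {r} X s y = trans (cong (_∩ (s Vec.++ y)) (sym (take++drop≡id r X)))
  (zipWith-++ _∧_ (take r X) (drop r X) s y)

∩-++-injective : (X : Subset (r + w)) (a s : Subset r) (x y : Subset w) →
  X ∩ (s Vec.++ y) ≡ (a Vec.++ x) ∩ (s Vec.++ y) → take r X ∩ s ≡ a ∩ s × drop r X ∩ y ≡ x ∩ y
∩-++-injective {r} X a s x y eq = ++-injective (take r X ∩ s) (a ∩ s)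
  (trans (sym (∩-++ X s y)) (trans eq (zipWith-++ _∧_ a x s y)))

-- The ground set is split as r + w. In the ball of radius k, each k-set a inside the first part
-- is replaced by a ∪ {f a}, with f a in the second part.
module Replacement {r w : ℕ} (k : ℕ) (f : Subset r → Fin w) where

  pairs : Subset r → Subset w → Bool
  pairs a x = if ∣ a ∣ ≡ᵇ k then does (x ≟ˢ ⁅ f a ⁆) else (∣ a ∣ + ∣ x ∣ <ᵇ suc k)

  swapped : Indicator (r + w)
  swapped X = pairs (take r X) (drop r X)

  swapped-++ : ∀ a x → swapped (a Vec.++ x) ≡ pairs a x
  swapped-++ a x = cong₂ pairs (take-++ a x) (drop-++ a x)

  pairs-layer : ∀ a x → ∣ a ∣ ≡ k → pairs a x ≡ true → x ≡ ⁅ f a ⁆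
  pairs-layer a x ∣a∣≡k p with ∣ a ∣ ≡ᵇ k | ≡⇒≡ᵇ ∣ a ∣ k ∣a∣≡k
  ... | true | _ with yes x≡ ← x ≟ˢ ⁅ f a ⁆ = x≡

  layer-pairs : ∀ a → ∣ a ∣ ≡ k → pairs a ⁅ f a ⁆ ≡ true
  layer-pairs a ∣a∣≡k with ∣ a ∣ ≡ᵇ k | ≡⇒≡ᵇ ∣ a ∣ k ∣a∣≡k
  ... | true | _ = dec-true (⁅ f a ⁆ ≟ˢ ⁅ f a ⁆) refl

  off-layer : ∀ a x → ∣ a ∣ ≢ k → pairs a x ≡ (∣ a ∣ + ∣ x ∣ <ᵇ suc k)
  off-layer a x ∣a∣≢k with ∣ a ∣ ≡ᵇ k | ≡ᵇ⇒≡ ∣ a ∣ k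
  ... | true  | ∣a∣≡k = contradiction (∣a∣≡k _) ∣a∣≢k
  ... | false | _     = refl

  off-layer-≤ : ∀ a x → ∣ a ∣ ≢ k → pairs a x ≡ true → ∣ a ∣ + ∣ x ∣ ≤ k
  off-layer-≤ a x ∣a∣≢k p =
    s≤s⁻¹ (<ᵇ⇒< (∣ a ∣ + ∣ x ∣) (suc k) (from T-≡ (trans (sym (off-layer a x ∣a∣≢k)) p)))

  -- Over a `k`-set `a` the fibre of the ball is the single point `⊥` and the new fibre is the
  -- single point `⁅ f a ⁆`; all other fibres are unchanged.
  size-swapped : size swapped ≡ binom≤ (r + w) k
  size-swapped = trans (size-fibres r w swapped (λ X → ∣ X ∣ <ᵇ suc k) fibre)
    (trans (size-ball (r + w) (suc k)) (sym (binom≤≡binom< (r + w) k)))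
    where
    fibre : ∀ a → size {w} (λ x → swapped (a Vec.++ x)) ≡ size {w} (λ x → ∣ a Vec.++ x ∣ <ᵇ suc k)
    fibre a with ∣ a ∣ ≟ k
    ... | yes ∣a∣≡k = trans
      (size-singleton ⁅ f a ⁆ (trans (swapped-++ a ⁅ f a ⁆) (layer-pairs a ∣a∣≡k))
        λ x p → pairs-layer a x ∣a∣≡k (trans (sym (swapped-++ a x)) p))
      (sym (size-singleton (⊥ {n = w})
        (to T-≡ (<⇒<ᵇ (s≤s (≤-reflexive (trans (∣++∣ a (⊥ {n = w})) (trans (cong₂ _+_ ∣a∣≡k (∣⊥∣≡0 w)) (+-identityʳ k)))))))
        λ x p → ∣x∣≡0⇒x≡⊥ x (n≤0⇒n≡0 (+-cancelˡ-≤ k ∣ x ∣ 0 (begin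
          k + ∣ x ∣      ≡⟨ cong (_+ ∣ x ∣) ∣a∣≡k ⟨
          ∣ a ∣ + ∣ x ∣  ≡⟨ ∣++∣ a x ⟨
          ∣ a Vec.++ x ∣ ≤⟨ s≤s⁻¹ (<ᵇ⇒< _ (suc k) (from T-≡ p)) ⟩
          k              ≡⟨ +-identityʳ k ⟨
          k + 0          ∎)))))
      where open ≤-Reasoning
    ... | no ∣a∣≢k = size-cong λ x → trans (swapped-++ a x)
      (trans (off-layer a x ∣a∣≢k) (cong (_<ᵇ suc k) (sym (∣++∣ a x))))

  -- A shattered (k+1)-set S is itself a member, say S = a ∪ {f a}; but no member meets S exactly in a.
  VC<-swapped : VC< (suc k) swapped
  VC<-swapped S sh = ≰⇒> λ k<S → impossible k<S
    where
    open ≤-Reasoning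
    impossible : ¬ (suc k ≤ ∣ S ∣)
    -- The trace `S` itself requires a member `B` containing `S`. It has more than `k` elements, so
    -- its first part must be a `k`-set.
    impossible k<S with B , pB , eq ← sh S with ∣ take r B ∣ ≟ k
    ... | no  ∣b∣≢k = contradiction k<S (<⇒≱ (s≤s (begin
      ∣ S ∣                         ≡⟨ cong ∣_∣ (trans eq (∩-idem S)) ⟨
      ∣ B ∩ S ∣                     ≤⟨ ∣p∩q∣≤∣p∣ B S ⟩
      ∣ B ∣                         ≡⟨ cong ∣_∣ (take++drop≡id r B) ⟨
      ∣ take r B Vec.++ drop r B ∣  ≡⟨ ∣++∣ (take r B) (drop r B) ⟩
      ∣ take r B ∣ + ∣ drop r B ∣   ≤⟨ off-layer-≤ (take r B) (drop r B) ∣b∣≢k pB ⟩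
      k                             ∎)))
    ... | yes ∣b∣≡k = no-trace (sh (b Vec.++ ⊥))
      where
      b : Subset r
      b = take r B
      j : Subset w
      j = ⁅ f b ⁆
      B≡b++j : B ≡ b Vec.++ j
      B≡b++j = trans (sym (take++drop≡id r B)) (cong (b Vec.++_) (pairs-layer b (drop r B) ∣b∣≡k pB))
      ∣B∣≡1+k : ∣ B ∣ ≡ suc k
      ∣B∣≡1+k = trans (cong ∣_∣ B≡b++j) (trans (∣++∣ b j)
        (trans (cong₂ _+_ ∣b∣≡k (∣⁅x⁆∣≡1 (f b))) (+-comm k 1)))
      S≡b++j : S ≡ b Vec.++ j
      S≡b++j = trans (sym (trans eq (∩-idem S))) (trans (∣B∣≤∣B∩S∣⇒B∩S≡B B S (begin
        ∣ B ∣      ≡⟨ ∣B∣≡1+k ⟩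
        suc k      ≤⟨ k<S ⟩
        ∣ S ∣      ≡⟨ cong ∣_∣ (trans eq (∩-idem S)) ⟨
        ∣ B ∩ S ∣  ∎)) B≡b++j)
      no-trace : ¬ (∃ λ Y → swapped Y ≡ true × Y ∩ S ≡ (b Vec.++ ⊥) ∩ S)
      -- The first part of `Y` contains `b`, and its second part misses `j`. If the first part has
      -- size `k`, it equals `b` and the second part is `j` after all. Otherwise it has at most `k`
      -- elements, yet contains the `k`-set `b`, so its size is `k` again.
      no-trace (Y , pY , eqY)
        with split ← ∩-++-injective Y b b ⊥ j (subst (λ S → Y ∩ S ≡ (b Vec.++ ⊥) ∩ S) S≡b++j eqY)
        with ∣ take r Y ∣ ≟ k
      ... | yes ∣c∣≡k = contradiction (begin-equality
          1              ≡⟨ ∣⁅x⁆∣≡1 (f b) ⟨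
          ∣ j ∣          ≡⟨ cong ∣_∣ (∩-idem j) ⟨
          ∣ j ∩ j ∣
            ≡⟨ cong (λ z → ∣ z ∩ j ∣) (trans (cong (λ a → ⁅ f a ⁆) (sym c≡b)) (sym (pairs-layer (take r Y) (drop r Y) ∣c∣≡k pY))) ⟩
          ∣ drop r Y ∩ j ∣ ≡⟨ cong ∣_∣ (trans (proj₂ split) (∩-zeroˡ j)) ⟩
          ∣ ⊥ {n = w} ∣  ≡⟨ ∣⊥∣≡0 w ⟩
          0              ∎) λ ()
        where
        c∩b≡b : take r Y ∩ b ≡ b
        c∩b≡b = trans (proj₁ split) (∩-idem b)
        c≡b : take r Y ≡ b
        c≡b = trans (sym (∣B∣≤∣B∩S∣⇒B∩S≡B (take r Y) b
          (≤-reflexive (trans ∣c∣≡k (trans (sym ∣b∣≡k) (cong ∣_∣ (sym c∩b≡b))))))) c∩b≡b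
      ... | no  ∣c∣≢k = ∣c∣≢k (≤-antisym (≤-trans (m≤m+n _ _) (off-layer-≤ (take r Y) (drop r Y) ∣c∣≢k pY)) (begin
          k                 ≡⟨ ∣b∣≡k ⟨
          ∣ b ∣             ≡⟨ cong ∣_∣ (trans (proj₁ split) (∩-idem b)) ⟨
          ∣ take r Y ∩ b ∣  ≤⟨ ∣p∩q∣≤∣p∣ (take r Y) b ⟩
          ∣ take r Y ∣      ∎))

  -- The shattered set lies in the second part: as `1 ≤ k`, the fibre over the empty first part is
  -- that of the ball and contains all subsets of a `k`-set `y`.
  swapped-shatters : 1 ≤ k → k ≤ w → ∃ λ S → ∣ S ∣ ≡ k × Shatters swapped S
  swapped-shatters 1≤k k≤w with y , ∣y∣≡k ← subset-of-size k≤w =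
    ⊥ {n = r} Vec.++ y , trans (∣++∣ (⊥ {n = r}) y) (cong₂ _+_ (∣⊥∣≡0 r) ∣y∣≡k) , trace
    where
    ∅ : Subset r
    ∅ = ⊥
    ∣∅∣≢k : ∣ ∅ ∣ ≢ k
    ∣∅∣≢k eq = contradiction 1≤k (<⇒≱ (s≤s (≤-reflexive (trans (sym eq) (∣⊥∣≡0 r)))))
    trace : Shatters swapped (∅ Vec.++ y)
    trace A = ∅ Vec.++ x , trans (swapped-++ ∅ x) (trans (off-layer ∅ x ∣∅∣≢k)
        (to T-≡ (<⇒<ᵇ (s≤s (begin
          ∣ ∅ ∣ + ∣ x ∣  ≡⟨ cong (_+ ∣ x ∣) (∣⊥∣≡0 r) ⟩
          ∣ x ∣          ≤⟨ ∣p∩q∣≤∣q∣ (drop r A) y ⟩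
          ∣ y ∣          ≡⟨ ∣y∣≡k ⟩
          k              ∎)))))
      , trans (zipWith-++ _∧_ ∅ x ∅ y) (trans
          (cong₂ Vec._++_ (trans (∩-zeroʳ ∅) (sym (∩-zeroʳ (take r A))))
                          (trans (∩-assoc (drop r A) y y) (cong (drop r A ∩_) (∩-idem y))))
          (sym (∩-++ A ∅ y)))
      where
      open ≤-Reasoning
      x : Subset w
      x = drop r A ∩ y

open Replacement

-- Counting the replacements

-- The fibre over a `k`-set `a` consists of `⁅ f a ⁆` alone, so `f a` can be read off from it.
swapped-injective : {f g : Subset r → Fin w} → (∀ X → swapped k f X ≡ swapped k g X) →
  ∀ {a} → ∣ a ∣ ≡ k → f a ≡ g a
swapped-injective {k = k} {f} {g} eq {a} ∣a∣≡k = x∈⁅y⁆⇒x≡y (g a) (subst (f a ∈ˢ_) ⁅fa⁆≡⁅ga⁆ (x∈⁅x⁆ (f a)))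
  where
  ⁅fa⁆≡⁅ga⁆ : ⁅ f a ⁆ ≡ ⁅ g a ⁆
  ⁅fa⁆≡⁅ga⁆ = pairs-layer k g a ⁅ f a ⁆ ∣a∣≡k (trans (sym (swapped-++ k g a ⁅ f a ⁆)) (trans (sym (eq (a Vec.++ ⁅ f a ⁆)))
    (trans (swapped-++ k f a ⁅ f a ⁆) (layer-pairs k f a ∣a∣≡k))))

lookup-injective : {xs : List A} → Unique xs → ∀ {i j} → lookup xs i ≡ lookup xs j → i ≡ j
lookup-injective {xs = x ∷ xs} _          {zero}  {zero}  eq = refl
lookup-injective {xs = x ∷ xs} (x∉ ∷ _)   {zero}  {suc j} eq = contradiction eq (All.lookup x∉ (∈-lookup j))
lookup-injective {xs = x ∷ xs} (x∉ ∷ _)   {suc i} {zero}  eq = contradiction (sym eq) (All.lookup x∉ (∈-lookup i))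
lookup-injective {xs = x ∷ xs} (_ ∷ u)    {suc i} {suc j} eq = cong suc (lookup-injective u eq)

funToFin-cong : ∀ {m n} {f g : Fin m → Fin n} → (∀ i → f i ≡ g i) → funToFin f ≡ funToFin g
funToFin-cong {zero}  f≗g = refl
funToFin-cong {suc m} f≗g = cong₂ combine (f≗g zero) (funToFin-cong (f≗g ∘ suc))

family-injective : {P Q : Indicator n} → family P ≡ family Q → ∀ x → P x ≡ Q x
family-injective {P = P} {Q} eq x with P x in p | Q x in q
... | false | false = refl
... | true  | true  = refl
... | true  | false = trans (sym (family⊑ x (subst (λ F → indicator F x ≡ true) eq (⊑family x p)))) q
... | false | true  = trans (sym p) (family⊑ x (subst (λ F → indicator F x ≡ true) (sym eq) (⊑family x q)))

-- The functions from the `k`-sets of the first part to the second are numbered by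
-- `Fin (suc w ^ length layer)`, and distinct functions give distinct maximal families.
m-lower : ∀ r w k → 1 ≤ k → k ≤ suc w → suc w ^ (r C k) ≤ m (r + suc w) k
m-lower r w k 1≤k k≤w = begin
  suc w ^ (r C k)
    ≡⟨ cong (suc w ^_) (trans (length-family (λ (a : Subset r) → ∣ a ∣ ≡ᵇ k)) (size-layer r k)) ⟨
  suc w ^ length layer
    ≡⟨ length-tabulate {n = suc w ^ length layer} id ⟨
  length (allFin (suc w ^ length layer))
    ≡⟨ length-map member (allFin (suc w ^ length layer)) ⟨
  length (map member (allFin (suc w ^ length layer)))
    ≤⟨ length-⊆ (Unique.map⁺ member-injective (Unique.allFin⁺ (suc w ^ length layer))) member-maximal ⟩
  m (r + suc w) k ∎
  where
  open ≤-Reasoning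
  layer : Family r
  layer = family (λ a → ∣ a ∣ ≡ᵇ k)
  choice : Fin (suc w ^ length layer) → Subset r → Fin (suc w)
  choice j a with a ∈? layer
  ... | yes a∈ = finToFun j (index a∈)
  -- A default value: `swapped` consults the function on `k`-sets only.
  ... | no  _  = zero
  choice-lookup : ∀ j i → choice j (lookup layer i) ≡ finToFun j i
  choice-lookup j i with lookup layer i ∈? layer
  ... | yes a∈ = cong (finToFun j) (lookup-injective
    (Unique.filter⁺ _ (allSubsets-unique r)) (sym (lookup-index a∈)))
  ... | no a∉ = contradiction (∈-lookup i) a∉
  ∣lookup∣ : ∀ i → ∣ lookup layer i ∣ ≡ k
  ∣lookup∣ i = ≡ᵇ⇒≡ _ k (from T-≡ (proj₂ (∈-filter⁻ (λ a → (∣ a ∣ ≡ᵇ k) ≟ᵇ true) {xs = allSubsets r} (∈-lookup i))))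
  member : Fin (suc w ^ length layer) → Family (r + suc w)
  member j = family (swapped k (choice j))
  member-injective : ∀ {i j} → member i ≡ member j → i ≡ j
  member-injective {i} {j} eq = trans (sym (funToFin-finToFin {length layer} i))
    (trans (funToFin-cong same) (funToFin-finToFin {length layer} j))
    where
    same : ∀ p → finToFun i p ≡ finToFun j p
    same p = trans (sym (choice-lookup i p)) (trans
      (swapped-injective {f = choice i} {choice j} (family-injective eq) (∣lookup∣ p)) (choice-lookup j p))
  member-maximal : map member (allFin _) ⊆ filter (λ F → isMaximalVC F k ≟ᵇ true) (sublists (allSubsets (r + suc w)))
  member-maximal F∈ with j , _ , refl ← ∈-map⁻ member F∈ = ∈-filter⁺ (λ F → isMaximalVC F k ≟ᵇ true)
    (filter-∈-sublists _ (allSubsets (r + suc w)))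
    (family-maximal (swapped-shatters k (choice j) 1≤k k≤w) (VC<-swapped k (choice j)) (size-swapped k (choice j)))

-- Asymptotics

-- The connected families number at most 2^n 4^B n^B with B = binom≤ n k close to n C k, and the
-- factors with base 2 are absorbed by one extra n^{C/2}; the (2q)-th power clears the denominator.
m^q≤ : ∀ n k p q .{{_ : NonZero n}} .{{_ : NonZero q}} → 1 ≤ p →
  (2 + 2 * q) * suc k ≤ suc n → 2 ^ (10 * q) ≤ n →
  m n (suc k) ^ q ≤ n ^ ((q + p) * (n C suc k))
m^q≤ n k p q@(suc q-1) 1≤p small large = ^-cancelʳ-≤ (2 * q) (begin
  (m n (suc k) ^ q) ^ (2 * q)                               ≡⟨ ^-*-assoc (m n (suc k)) q (2 * q) ⟩
  m n (suc k) ^ e                                           ≤⟨ ^-monoˡ-≤ e m≤ ⟩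
  (2 ^ (c + (b + b)) * n ^ b) ^ e                           ≡⟨ ^-distribʳ-* e (2 ^ (c + (b + b))) (n ^ b) ⟩
  (2 ^ (c + (b + b))) ^ e * (n ^ b) ^ e
    ≡⟨ cong₂ _*_ (^-*-assoc 2 (c + (b + b)) e) (^-*-assoc n b e) ⟩
  2 ^ ((c + (b + b)) * e) * n ^ (b * e)
    ≤⟨ *-mono-≤ (^-monoʳ-≤ 2 two-exponent) (^-monoʳ-≤ n n-exponent) ⟩
  2 ^ (10 * q * (q * c)) * n ^ (q * (suc (2 * q) * c))
    ≡⟨ cong (_* n ^ (q * (suc (2 * q) * c))) (^-*-assoc 2 (10 * q) (q * c)) ⟨
  (2 ^ (10 * q)) ^ (q * c) * n ^ (q * (suc (2 * q) * c))    ≤⟨ *-monoˡ-≤ _ (^-monoˡ-≤ (q * c) large) ⟩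
  n ^ (q * c) * n ^ (q * (suc (2 * q) * c))                 ≡⟨ ^-distribˡ-+-* n (q * c) _ ⟨
  n ^ (q * c + q * (suc (2 * q) * c))                       ≡⟨ cong (n ^_) (solve 2 (λ q c →
                                                                 q :* c :+ q :* ((con 1 :+ con 2 :* q) :* c) :=
                                                                 (q :+ con 1) :* c :* (con 2 :* q)) refl q c) ⟩
  n ^ ((q + 1) * c * (2 * q))
    ≤⟨ ^-monoʳ-≤ n (*-monoˡ-≤ (2 * q) (*-monoˡ-≤ c (+-monoʳ-≤ q 1≤p))) ⟩
  n ^ ((q + p) * c * (2 * q))                               ≡⟨ ^-*-assoc n ((q + p) * c) (2 * q) ⟨
  (n ^ ((q + p) * c)) ^ (2 * q)                             ∎)
  where
  open ≤-Reasoning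
  open +-*-Solver
  b = binom≤ n (suc k)
  c = n C suc k
  e = q * (2 * q)
  ratio : 2 * q * b ≤ suc (2 * q) * c
  ratio = binom≤-ratio (2 * q) n (suc k) small
  n≤c : n ≤ c
  n≤c = n≤nCk n k (≤-trans (*-monoˡ-≤ (suc k) (m≤m+n 2 (2 * q))) small)
  b-predecessor : ∃ λ t → b ≡ suc t
  b-predecessor with b | ≤-trans (≤-trans (>-nonZero⁻¹ n) n≤c) (m≤n+m c (binom≤ n k))
  ... | suc t | _ = t , refl
  m≤ : m n (suc k) ≤ 2 ^ (c + (b + b)) * n ^ b
  m≤ with t , b≡ ← b-predecessor = begin
    m n (suc k)                        ≤⟨ m-upper n (suc k) t b≡ ⟩
    2 ^ n * (2 ^ (t + t) * n ^ t)
      ≤⟨ *-mono-≤ (^-monoʳ-≤ 2 n≤c) (*-mono-≤ (^-monoʳ-≤ 2 (+-mono-≤ t≤b t≤b)) (^-monoʳ-≤ n t≤b)) ⟩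
    2 ^ c * (2 ^ (b + b) * n ^ b)      ≡⟨ *-assoc (2 ^ c) (2 ^ (b + b)) (n ^ b) ⟨
    2 ^ c * 2 ^ (b + b) * n ^ b        ≡⟨ cong (_* n ^ b) (^-distribˡ-+-* 2 c (b + b)) ⟨
    2 ^ (c + (b + b)) * n ^ b          ∎
    where
    t≤b : t ≤ b
    t≤b = ≤-trans (n≤1+n t) (≤-reflexive (sym b≡))
  -- By `ratio`, `c + 2b` is at most `(3 + 1/q) c`. Multiplied by `e` this is `q c (6q + 2)`,
  -- rounded up to match `2 ^ (10 * q) ≤ n`.
  two-exponent : (c + (b + b)) * e ≤ 10 * q * (q * c)
  two-exponent = begin
    (c + (b + b)) * e
      ≡⟨ solve 3 (λ b c q → (c :+ (b :+ b)) :* (q :* (con 2 :* q)) :=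
                                                                 q :* (con 2 :* q :* c :+ (con 2 :* q :* b :+ con 2 :* q :* b))) refl b c q ⟩
    q * (2 * q * c + (2 * q * b + 2 * q * b))
      ≤⟨ *-monoʳ-≤ q (+-monoʳ-≤ (2 * q * c) (+-mono-≤ ratio ratio)) ⟩
    q * (2 * q * c + (suc (2 * q) * c + suc (2 * q) * c))
      ≡⟨ solve 2 (λ c q → q :* (con 2 :* q :* c :+ ((con 1 :+ con 2 :* q) :* c :+ (con 1 :+ con 2 :* q) :* c)) :=
                                                                 q :* c :* (con 6 :* q :+ con 2 :* con 1)) refl c q ⟩
    q * c * (6 * q + 2 * 1)
      ≤⟨ *-monoʳ-≤ (q * c) (+-monoʳ-≤ (6 * q) (*-monoʳ-≤ 2 (>-nonZero⁻¹ q))) ⟩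
    q * c * (6 * q + 2 * q)
      ≤⟨ *-monoʳ-≤ (q * c) (m≤m+n (6 * q + 2 * q) (2 * q)) ⟩
    q * c * (6 * q + 2 * q + 2 * q)
      ≡⟨ solve 2 (λ c q → q :* c :* (con 6 :* q :+ con 2 :* q :+ con 2 :* q) :=
                                                                 con 10 :* q :* (q :* c)) refl c q ⟩
    10 * q * (q * c)                                         ∎
  n-exponent : b * e ≤ q * (suc (2 * q) * c)
  n-exponent = begin
    b * e
      ≡⟨ solve 2 (λ b q → b :* (q :* (con 2 :* q)) := q :* (con 2 :* q :* b)) refl b q ⟩
    q * (2 * q * b)           ≤⟨ *-monoʳ-≤ q ratio ⟩
    q * (suc (2 * q) * c)     ∎

-- Two losses in the exponent, each a factor of at least `(2q + 1) / (2q + 2)`: one from the sets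
-- that meet the second part, one from the base `suc w` in place of `N`. Their product exceeds
-- `q / (q + 1)`, because `(2q + 1)^2 = 4q(q + 1) + 1`.
m^q≥-split : ∀ r w k q .{{_ : NonZero (r + suc w)}} → suc k ≤ suc w → 2 * suc q * (suc w * suc k) ≤ r + suc w →
  (r + suc w) ^ suc (2 * q) ≤ suc w ^ (2 * suc q) →
  (r + suc w) ^ (q * ((r + suc w) C suc k)) ≤ m (r + suc w) (suc k) ^ suc q
m^q≥-split r w k q k≤w small large = ≤-trans (^-cancelʳ-≤ (4 * suc q) (begin
  (N ^ (q * c′)) ^ (4 * suc q)                   ≡⟨ ^-*-assoc N (q * c′) (4 * suc q) ⟩
  N ^ (q * c′ * (4 * suc q))                     ≤⟨ ^-monoʳ-≤ N exponent ⟩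
  N ^ (suc (2 * q) * (2 * suc q * c))           ≡⟨ ^-*-assoc N (suc (2 * q)) (2 * suc q * c) ⟨
  (N ^ suc (2 * q)) ^ (2 * suc q * c)           ≤⟨ ^-monoˡ-≤ (2 * suc q * c) large ⟩
  (suc w ^ (2 * suc q)) ^ (2 * suc q * c)       ≡⟨ ^-*-assoc (suc w) (2 * suc q) (2 * suc q * c) ⟩
  suc w ^ (2 * suc q * (2 * suc q * c))
    ≡⟨ cong (suc w ^_) (solve 2 (λ q c → con 2 :* q :* (con 2 :* q :* c) := c :* q :* (con 4 :* q)) refl (suc q) c) ⟩
  suc w ^ (c * suc q * (4 * suc q))             ≡⟨ ^-*-assoc (suc w) (c * suc q) (4 * suc q) ⟨
  (suc w ^ (c * suc q)) ^ (4 * suc q)           ≡⟨ cong (_^ (4 * suc q)) (^-*-assoc (suc w) c (suc q)) ⟨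
  ((suc w ^ c) ^ suc q) ^ (4 * suc q)           ∎)) (^-monoˡ-≤ (suc q) (m-lower r w (suc k) (s≤s z≤n) k≤w))
  where
  open ≤-Reasoning
  open +-*-Solver
  N = r + suc w
  c = r C suc k
  c′ = N C suc k
  kept : suc (2 * q) * c′ ≤ 2 * suc q * c
  kept = +-cancelʳ-≤ c′ _ _ (begin
    suc (2 * q) * c′ + c′
      ≡⟨ solve 2 (λ q c → (con 1 :+ con 2 :* q) :* c :+ c := con 2 :* (con 1 :+ q) :* c) refl q c′ ⟩
    2 * suc q * c′            ≤⟨ C-deletion-ratio (2 * suc q) r w k small ⟩
    2 * suc q * c + c′        ∎)
  exponent : q * c′ * (4 * suc q) ≤ suc (2 * q) * (2 * suc q * c)
  exponent = begin
    q * c′ * (4 * suc q)                   ≤⟨ m≤m+n _ c′ ⟩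
    q * c′ * (4 * suc q) + c′               ≡⟨ solve 2 (λ q c → q :* c :* (con 4 :* (con 1 :+ q)) :+ c :=
                                               (con 1 :+ con 2 :* q) :* ((con 1 :+ con 2 :* q) :* c)) refl q c′ ⟩
    suc (2 * q) * (suc (2 * q) * c′)       ≤⟨ *-monoʳ-≤ (suc (2 * q)) kept ⟩
    suc (2 * q) * (2 * suc q * c)         ∎

-- The second part u = ⌊n / 2qk⌋ is so small that most k-sets avoid it, yet u ≥ n^{1-o(1)}
-- (with q and k shifted by one below).
m^q≥ : ∀ n k q → (4 * suc q * suc k) ^ (2 * suc q) ≤ n → n ^ (q * (n C suc k)) ≤ m n (suc k) ^ suc q
m^q≥ n k q large = subst (λ n → n ^ (q * (n C suc k)) ≤ m n (suc k) ^ suc q) v+u≡n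
  (m^q≥-split v (pred u) k q {{subst NonZero (sym v+u≡n) nz-n}}
    (subst (suc k ≤_) (sym u≡) k≤u)
    (subst₂ _≤_ (trans (solve 3 (λ s k u → u :* (s :* k) := s :* (u :* k)) refl (2 * suc q) (suc k) u)
                       (cong (λ u → 2 * suc q * (u * suc k)) (sym u≡))) (sym v+u≡n) (m/n*n≤m n s))
    (subst₂ _≤_ (cong (_^ suc (2 * q)) (sym v+u≡n)) (cong (_^ (2 * suc q)) (sym u≡)) power))
  where
  open ≤-Reasoning
  open +-*-Solver
  -- `h` is `2 * s`: the factor 2 absorbs the rounding in `u`, so that `n ≤ h * u`, while `large`
  -- keeps `h` below the `e`-th root of `n`.
  h = 4 * suc q * suc k
  s = 2 * suc q * suc k
  e = 2 * suc q
  u = n / s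
  v = n ∸ u
  h≤hᵉ : h ≤ h ^ e
  h≤hᵉ = m≤m^[1+e] h (pred e)
  nz-n : NonZero n
  nz-n = >-nonZero (≤-trans (s≤s z≤n) (≤-trans h≤hᵉ large))
  instance _ = nz-n
  h≡2s : h ≡ 2 * s
  h≡2s = solve 2 (λ q k → con 4 :* q :* k := con 2 :* (con 2 :* q :* k)) refl (suc q) (suc k)
  hh≤n : h * h ≤ n
  hh≤n = begin
    h * h      ≡⟨ cong (h *_) (*-identityʳ h) ⟨
    h ^ 2      ≤⟨ ^-monoʳ-≤ h (*-monoʳ-≤ 2 (s≤s (z≤n {q}))) ⟩
    h ^ e      ≤⟨ large ⟩
    n          ∎
  k≤u : suc k ≤ u
  k≤u = begin
    suc k              ≡⟨ m*n/n≡m (suc k) s ⟨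
    suc k * s / s
      ≤⟨ /-monoˡ-≤ s (≤-trans (*-mono-≤ (m≤n*m (suc k) (4 * suc q)) (≤-trans (m≤n*m s 2) (≤-reflexive (sym h≡2s)))) hh≤n) ⟩
    n / s              ∎
  u≡ : suc (pred u) ≡ u
  u≡ = suc-pred u {{>-nonZero (≤-trans (s≤s z≤n) k≤u)}}
  u≤n : u ≤ n
  u≤n = ≤-trans (m≤m*n u s) (m/n*n≤m n s)
  v+u≡n : v + suc (pred u) ≡ n
  v+u≡n = trans (cong (v +_) u≡) (m∸n+n≡m u≤n)
  n≤hu : n ≤ h * u
  n≤hu = begin
    n                ≡⟨ m≡m%n+[m/n]*n n s ⟩
    n % s + u * s    ≤⟨ +-monoˡ-≤ (u * s) (<⇒≤ (m%n<n n s)) ⟩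
    s + u * s        ≤⟨ +-monoˡ-≤ (u * s) (m≤n*m s u {{>-nonZero (≤-trans (s≤s z≤n) k≤u)}}) ⟩
    u * s + u * s    ≡⟨ solve 2 (λ u s → u :* s :+ u :* s := con 2 :* s :* u) refl u s ⟩
    2 * s * u        ≡⟨ cong (_* u) h≡2s ⟨
    h * u            ∎
  -- Raising `n ≤ h * u` to the power `e` costs `h ^ e ≤ n`; cancelling one factor `n` leaves the
  -- exponent `e - 1 = 2q + 1`.
  power : n ^ suc (2 * q) ≤ u ^ e
  power = *-cancelˡ-≤ n (begin
    n ^ (2 + 2 * q)  ≡⟨ cong (n ^_) (*-suc 2 q) ⟨
    n ^ e            ≤⟨ ^-monoˡ-≤ e n≤hu ⟩
    (h * u) ^ e      ≡⟨ ^-distribʳ-* e h u ⟩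
    h ^ e * u ^ e    ≤⟨ *-monoˡ-≤ (u ^ e) large ⟩
    n * u ^ e        ∎)

-- After squaring, one factor `n` pays for the constant `c` and the other for `k n`, by the
-- hypothesis with exponent `1 / (2e)`.
subpolynomial-scale : (k : ℕ → ℕ) →
  (∀ p q → 1 ≤ p → 1 ≤ q → ∃ λ N → ∀ n → N ≤ n → k n ^ q ≤ n ^ p) →
  ∀ c e → 1 ≤ e → ∃ λ N → ∀ n → N ≤ n → (c * k n) ^ e ≤ n
subpolynomial-scale k k≤nᵒ⁽¹⁾ c e 1≤e
  with N , kN ← k≤nᵒ⁽¹⁾ 1 (e * 2) ≤-refl (*-mono-≤ 1≤e (s≤s (z≤n {1})))
  = N ⊔ c ^ (e * 2) , λ n N≤n → ^-cancelʳ-≤ 2 (begin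
      ((c * k n) ^ e) ^ 2              ≡⟨ ^-*-assoc (c * k n) e 2 ⟩
      (c * k n) ^ (e * 2)              ≡⟨ ^-distribʳ-* (e * 2) c (k n) ⟩
      c ^ (e * 2) * k n ^ (e * 2)      ≤⟨ *-mono-≤ (m⊔n≤o⇒n≤o N _ N≤n) (kN n (m⊔n≤o⇒m≤o N _ N≤n)) ⟩
      n * n ^ 1                        ∎)
  where open ≤-Reasoning

-- Each `o(1)` is tested against the rationals `p / q`, with `q`-th powers clearing denominators.
-- The value `k = 0` is excluded: there the maximal families are the `2 ^ n` singletons, too many
-- for the formula.
theorem1p1 : (k : ℕ → ℕ) →
    (∀ n → 1 ≤ k n) →
    (∀ p q → 1 ≤ p → 1 ≤ q → ∃ λ N → ∀ n → N ≤ n → k n ^ q ≤ n ^ p) →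
    ∀ p q → 1 ≤ p → 1 ≤ q → ∃ λ N → ∀ n → N ≤ n →
    (n ^ ((q ∸ p) * (n C k n)) ≤ m n (k n) ^ q)
    × (m n (k n) ^ q ≤ n ^ ((q + p) * (n C k n)))
theorem1p1 k 1≤k k≤nᵒ⁽¹⁾ p@(suc p-1) q@(suc q-1) 1≤p 1≤q
  with N , scale ← subpolynomial-scale k k≤nᵒ⁽¹⁾ (4 * q) (2 * q) (s≤s z≤n)
  -- The bound from `scale` drives the lower bound and also yields `small` for the upper one;
  -- `2 ^ (10 * q) ≤ n` absorbs the powers of 2.
  = N ⊔ 2 ^ (10 * q) , λ n N≤n → bounds n (k n) (1≤k n) (scale n (m⊔n≤o⇒m≤o N _ N≤n)) (m⊔n≤o⇒n≤o N _ N≤n)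
  where
  open ≤-Reasoning
  bounds : ∀ n k → 1 ≤ k → (4 * q * k) ^ (2 * q) ≤ n → 2 ^ (10 * q) ≤ n →
    (n ^ ((q ∸ p) * (n C k)) ≤ m n k ^ q) × (m n k ^ q ≤ n ^ ((q + p) * (n C k)))
  bounds n (suc k) _ scale large =
      -- The case `p = 1` is the strongest: `q ∸ p` is at most `q - 1`.
      ≤-trans (^-monoʳ-≤ n (*-monoˡ-≤ (n C suc k) (m∸n≤m q-1 p-1))) (m^q≥ n k q-1 scale)
    , m^q≤ n k p q 1≤p small large
    where
    instance _ = >-nonZero (≤-trans (m^n>0 2 (10 * q)) large)
    small : (2 + 2 * q) * suc k ≤ suc n
    small = begin
      (2 + 2 * q) * suc k                ≤⟨ *-monoˡ-≤ (suc k) (+-monoˡ-≤ (2 * q) (*-monoʳ-≤ 2 1≤q)) ⟩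
      (2 * q + 2 * q) * suc k            ≡⟨ cong (_* suc k) (*-distribʳ-+ q 2 2) ⟨
      4 * q * suc k                      ≤⟨ m≤m^[1+e] (4 * q * suc k) (pred (2 * q)) ⟩
      (4 * q * suc k) ^ (2 * q)          ≤⟨ scale ⟩
      n                                  ≤⟨ n≤1+n n ⟩
      suc n                              ∎
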